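{- Let $Y_0=\{y_k\}_{k\ge 0}$. 1. The generating series $\mathrm{H}^-(N)=\sum_{w\in Y_0^*}\mathrm{H}^-_w(N)\,w$ is group-like (for the coproduct $\Delta_{*}$ dual to the quasi-shuffle product $*$ on $\mathbb{Q}\langle Y_0\rangle$) and $\log \mathrm{H}^-$ is primitive (for $\Delta_*$). Moreover, limits being taken coefficientwise, $$\lim_{N\to+\infty} g^{\odot -1}(N)\odot \mathrm{H}^-(N)=\lim_{z\to 1^- }h^{\odot -1}\big((1-z)^{ -1}\big)\odot \mathrm{L}^-(z)=C^-,$$ where $C^-=\sum_{w\in Y_0^*}C^-_w\,w$. 2. The kernel $\ker \mathrm{H}^-_\bullet$ of the linear map $\mathrm{H}^-_\bullet : w\mapsto \mathrm{H}^-_w$ (from $\mathbb{Q}\langle Y_0\rangle$ to functions of $N$) is a prime ideal of $(\mathbb{Q}\langle Y_0\rangle,*)$, i.e. $\mathbb{Q}\langle Y_0\rangle\setminus\ker \mathrm{H}^-_\bullet$ is closed under $*$.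
   Context: $Y_0=\{y_k\}_{k\ge0}$ is an infinite alphabet, $Y_0^*$ the free monoid on it with neutral element $1_{Y_0^*}$ (the empty word). For $w=y_{s_1}\cdots y_{s_r}\in Y_0^*$, the length is $|w|=r$ and the weight is $(w)=s_1+\cdots+s_r$ (both $0$ for the empty word). For $w=y_{s_1}\cdots y_{s_r}$, $N\in\mathbb{N}$ and $|z|<1$: $$\mathrm{H}^-_w(N)=\sum_{N\ge n_1>\cdots>n_r>0}n_1^{s_1}\cdots n_r^{s_r},\qquad \mathrm{Li}^-_w(z)=\sum_{n_1>\cdots>n_r>0}n_1^{s_1}\cdots n_r^{s_r}z^{n_1},$$ with $\mathrm{H}^-_{1_{Y_0^*}}=1$, $\mathrm{Li}^-_{1_{Y_0^*}}=1$. Both are extended linearly to polynomials in $\mathbb{Q}\langle Y_0\rangle$. The generating series are $\mathrm{L}^-(z)=\sum_{w\in Y_0^*}\mathrm{Li}^-_w(z)\,w$ and $\mathrm{H}^-(N)=\sum_{w\in Y_0^*}\mathrm{H}^-_w(N)\,w$. The quasi-shuffle product $*$ on $\mathbb{Q}\langle Y_0\rangle$ is bilinear with $w*1=1*w=w$ and $y_iu*y_jv=y_i(u*y_jv)+y_j(y_iu*v)+y_{i+j}(u*v)$ for $i,j\ge0$, $u,v\in Y_0^*$. Its dual coproduct is $\langle\Delta_{*}S\mid u\otimes v\rangle=\langle S\mid u* v\rangle$ for $u,v\in Y_0^*$. A series $S$ with constant term $1$ is group-like if $\Delta_*S=S\otimes S$; $S$ is primitive if $\Delta_*S=S\otimes1+1\otimes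 S$. The logarithm is taken with respect to concatenation. $\odot$ is the Hadamard (coefficientwise) product of series over $Y_0$, and for a series $S$ with all coefficients nonzero $S^{\odot-1}$ is the series whose coefficients are the inverses of those of $S$. Also $$g(t)=\sum_{w\in Y_0^*}t^{(w)+|w|}w,\qquad h(t)=\sum_{w\in Y_0^*}((w)+|w|)!\,t^{(w)+|w|}w,\qquad C^-_w=\prod_{w=uv,\ v\ne 1_{Y_0^*}}\frac1{(v)+|v|}\in\mathbb{Q},$$ where the product runs over all factorizations $w=uv$ with $v$ nonempty (so $C^-_{1_{Y_0^*}}=1$). -}

module Defs where

open import Data.Nat.Base as ℕ using (ℕ; zero; suc; pred; _!)
import Data.Nat.Properties as ℕ
open import Data.Integer.Base as ℤ using (+_)
import Data.Integer.Properties as ℤ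
open import Data.List.Base as List using (List; []; _∷_; [_]; _++_; length; map; concatMap; foldr)
open import Data.Product.Base using (∃; _×_; _,_; proj₁; map₁)
open import Data.Nat.ListAction using (sum)
open import Data.Rational.Base using
  (ℚ; mkℚ; toℚᵘ; _+_; _-_; _*_; -_; _/_; 1/_; ∣_∣; _≤_; _<_; 0ℚ; 1ℚ; ½; +-*-rawSemiring;
   positive; nonNegative; ≢-nonZero)
open import Data.Rational.Properties
open import Data.Rational.Solver using (module +-*-Solver)
import Data.Rational.Unnormalised.Base as ℚᵘ
import Data.Rational.Unnormalised.Properties as ℚᵘ
open import Algebra.Definitions.RawSemiring +-*-rawSemiring using (_^_)
open import Data.Sum.Base using (inj₁; inj₂)
open import Relation.Binary.PropositionalEquality
  using (_≡_; _≢_; refl; sym; trans; cong; cong₂; subst; subst₂)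
open import Relation.Nullary using (¬_; yes; no; contradiction)
open import Data.List.Properties using (≡-dec)

-- The word y_{s₁} ⋯ y_{s_r} is the list s₁ ∷ ⋯ ∷ s_r ∷ [].
Word : Set
Word = List ℕ

weight : Word → ℕ
weight = sum

degree : Word → ℕ
degree w = length w ℕ.+ weight w

factorizations : Word → List (Word × Word)
factorizations []      = [ [] , [] ]
factorizations (s ∷ w) = ([] , s ∷ w) ∷ map (map₁ (s ∷_)) (factorizations w)

Series : Set → Set
Series A = Word → A

sumℚ productℚ : List ℚ → ℚ
sumℚ     = foldr _+_ 0ℚ
productℚ = foldr _*_ 1ℚ

-- ℚ⟨Y₀⟩: formal finite ℚ-linear combinations of words, not necessarily in
-- reduced form; two of them are the same polynomial when related by _≋_.
Polynomial : Set
Polynomial = List (ℚ × Word)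

-- ⟨ S ∣ p ⟩; it is also the value at p of the linear extension of w ↦ S w.
⟨_∣_⟩ : Series ℚ → Polynomial → ℚ
⟨ S ∣ p ⟩ = sumℚ (map (λ (c , w) → c * S w) p)

coefficient : Word → Polynomial → ℚ
coefficient w = ⟨ δ ∣_⟩
  where
  δ : Series ℚ
  δ v with ≡-dec ℕ._≟_ w v
  ... | yes _ = 1ℚ
  ... | no  _ = 0ℚ

infix 4 _≋_
_≋_ : Polynomial → Polynomial → Set
p ≋ q = ∀ w → coefficient w p ≡ coefficient w q

0ᴾ 1ᴾ : Polynomial
0ᴾ = []
1ᴾ = [ 1ℚ , [] ]

infixl 6 _+ᴾ_
_+ᴾ_ : Polynomial → Polynomial → Polynomial
_+ᴾ_ = _++_

scale : ℚ → Polynomial → Polynomial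
scale c = map (map₁ (c *_))

prefix : ℕ → Polynomial → Polynomial
prefix s = map (λ (c , w) → c , s ∷ w)

infixl 7 _⋆ʷ_ _⋆_
_⋆ʷ_ : Word → Word → Polynomial
[]      ⋆ʷ v       = [ 1ℚ , v ]
(i ∷ u) ⋆ʷ []      = [ 1ℚ , i ∷ u ]
(i ∷ u) ⋆ʷ (j ∷ v) =
  prefix i (u ⋆ʷ (j ∷ v)) +ᴾ prefix j ((i ∷ u) ⋆ʷ v) +ᴾ prefix (i ℕ.+ j) (u ⋆ʷ v)

_⋆_ : Polynomial → Polynomial → Polynomial
p ⋆ q = concatMap (λ (a , u) → concatMap (λ (b , v) → scale (a * b) (u ⋆ʷ v)) q) p

Series² : Set
Series² = Word → Word → ℚ

infix 4 _≗²_
_≗²_ : Series² → Series² → Set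
A ≗² B = ∀ u v → A u v ≡ B u v

Δ : Series ℚ → Series²
Δ S u v = ⟨ S ∣ u ⋆ʷ v ⟩

infixl 7 _⊗_
_⊗_ : Series ℚ → Series ℚ → Series²
(S ⊗ T) u v = S u * T v

_+²_ : Series² → Series² → Series²
(A +² B) u v = A u v + B u v

1ˢ : Series ℚ
1ˢ []      = 1ℚ
1ˢ (_ ∷ _) = 0ℚ

GroupLike : Series ℚ → Set
GroupLike S = S [] ≡ 1ℚ × Δ S ≗² S ⊗ S

Primitive : Series ℚ → Set
Primitive S = Δ S ≗² (S ⊗ 1ˢ) +² (1ˢ ⊗ S)

sumTo : {A : Set} → (A → A → A) → A → ((n : ℕ) .{{_ : ℕ.NonZero n}} → A) → ℕ → A
sumTo _⊕_ 0# f zero    = 0#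
sumTo _⊕_ 0# f (suc N) = sumTo _⊕_ 0# f N ⊕ f (suc N)

infixl 7 _·_
_·_ : Series ℚ → Series ℚ → Series ℚ
(S · T) w = sumℚ (map (λ (u , v) → S u * T v) (factorizations w))

_^ˢ_ : Series ℚ → ℕ → Series ℚ
S ^ˢ zero  = 1ˢ
S ^ˢ suc n = S · (S ^ˢ n)

-- log S = ∑_{n≥1} (-1)ⁿ⁻¹/n (S - 1)ⁿ, for S with constant term 1.  Then S - 1
-- has no constant term, so the terms with n > |w| do not contribute to the
-- coefficient of w.
log : Series ℚ → Series ℚ
log S w = sumTo _+_ 0ℚ (λ n → (- 1ℚ) ^ pred n * (+ 1 / n) * ((λ v → S v - 1ˢ v) ^ˢ n) w) (length w)

record IsPrimeIdeal (I : Polynomial → Set) : Set where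
  field
    resp      : ∀ {p q} → p ≋ q → I p → I q
    zeroᴾ     : I 0ᴾ
    +-closed  : ∀ {p q} → I p → I q → I (p +ᴾ q)
    ⋆-closedˡ : ∀ p {q} → I q → I (p ⋆ q)
    ⋆-closedʳ : ∀ {p} q → I p → I (p ⋆ q)
    proper    : ¬ I 1ᴾ
    prime     : ∀ {p q} → ¬ I p → ¬ I q → ¬ I (p ⋆ q)

fromℕ : ℕ → ℚ
fromℕ n = + n / 1

mutual

  -- The sum of n₁^s₁ ⋯ n_r^s_r over N ≥ n₁ > ⋯ > n_r > 0.
  H : Word → ℕ → ℕ
  H []      N = 1
  H (s ∷ w) N = sumTo ℕ._+_ 0 (λ n → summand s w n) N

  -- The part of the sum for y_s w with n₁ = n; then n₂ ranges up to n - 1.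
  summand : ℕ → Word → ℕ → ℕ
  summand s w n = n ℕ.^ s ℕ.* H w (pred n)

H⁻ : ℕ → Series ℚ
H⁻ N w = fromℕ (H w N)

ker-H⁻ : Polynomial → Set
ker-H⁻ p = ∀ N → ⟨ H⁻ N ∣ p ⟩ ≡ 0ℚ

module S = +-*-Solver
open S using (_:=_; _:+_; _:*_; _:-_; :-_; con)

module ℚ-Order where

  0<1 : 0ℚ < 1ℚ
  0<1 = positive⁻¹ 1ℚ

  0<* : ∀ {p q} → 0ℚ < p → 0ℚ < q → 0ℚ < p * q
  0<* {p} {q} 0<p 0<q = positive⁻¹ (p * q) {{pos*pos⇒pos p {{positive 0<p}} q {{positive 0<q}}}}

  0≤* : ∀ {p q} → 0ℚ ≤ p → 0ℚ ≤ q → 0ℚ ≤ p * q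
  0≤* {p} {q} 0≤p 0≤q =
    nonNegative⁻¹ (p * q) {{nonNeg*nonNeg⇒nonNeg p {{nonNegative 0≤p}} q {{nonNegative 0≤q}}}}

  0<+ : ∀ {p q} → 0ℚ < p → 0ℚ ≤ q → 0ℚ < p + q
  0<+ {p} {q} a b = subst (_< p + q) (+-identityʳ 0ℚ) (+-mono-<-≤ a b)

  0≤+ : ∀ {p q} → 0ℚ ≤ p → 0ℚ ≤ q → 0ℚ ≤ p + q
  0≤+ {p} {q} a b = subst (_≤ p + q) (+-identityʳ 0ℚ) (+-mono-≤ a b)

  *-mono : ∀ {a b c d} → 0ℚ ≤ a → a ≤ b → 0ℚ ≤ c → c ≤ d → a * c ≤ b * d
  *-mono {a} {b} {c} {d} 0≤a a≤b 0≤c c≤d = ≤-trans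
    (*-monoʳ-≤-nonNeg c {{nonNegative 0≤c}} a≤b)
    (*-monoˡ-≤-nonNeg b {{nonNegative (≤-trans 0≤a a≤b)}} c≤d)

  ≤-diff : ∀ {p q} → p ≤ q → 0ℚ ≤ q - p
  ≤-diff {p} {q} p≤q = subst (_≤ q - p) (+-inverseʳ p) (+-monoˡ-≤ (- p) p≤q)

  <-diff : ∀ {p q} → p < q → 0ℚ < q - p
  <-diff {p} {q} p<q = subst (_< q - p) (+-inverseʳ p) (+-monoˡ-< (- p) p<q)

  diff-≤ : ∀ {p q} → 0ℚ ≤ q - p → p ≤ q
  diff-≤ {p} {q} h = subst₂ _≤_ (+-identityˡ p)
    (S.solve 2 (λ p q → (q :- p) :+ p := q) refl p q) (+-monoˡ-≤ p h)

  +-cancel-≤ : ∀ {p q} r → p + r ≤ q + r → p ≤ q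
  +-cancel-≤ {p} {q} r h = subst₂ _≤_ (e p r) (e q r) (+-monoˡ-≤ (- r) h)
    where e = S.solve 2 (λ p r → (p :+ r) :- r := p) refl

  recip : ∀ q → 0ℚ < q → ∃ λ r → 0ℚ < r × q * r ≡ 1ℚ
  recip q 0<q = 1/ q , positive⁻¹ (1/ q) {{1/pos⇒pos q}} , *-inverseʳ q
    where instance _ = positive 0<q
                   _ = pos⇒nonZero q {{positive 0<q}}

  0<½* : ∀ {ε} → 0ℚ < ε → 0ℚ < ½ * ε
  0<½* = 0<* (positive⁻¹ ½)

  halves : ∀ ε → ½ * ε + ½ * ε ≡ ε
  halves ε = trans (sym (*-distribʳ-+ ε ½ ½)) (*-identityˡ ε)

  ½≤ : ∀ {ε} → 0ℚ < ε → ½ * ε ≤ ε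
  ½≤ {ε} 0<ε = subst₂ _≤_ (+-identityʳ _) (halves ε) (+-monoʳ-≤ (½ * ε) (<⇒≤ (0<½* 0<ε)))

  ∣-∣-triangle : ∀ p q r → ∣ p - r ∣ ≤ ∣ p - q ∣ + ∣ q - r ∣
  ∣-∣-triangle p q r = subst (λ t → ∣ t ∣ ≤ ∣ p - q ∣ + ∣ q - r ∣)
    (S.solve 3 (λ p q r → (p :- q) :+ (q :- r) := p :- r) refl p q r)
    (∣p+q∣≤∣p∣+∣q∣ (p - q) (q - r))

  ∣-∣-swap : ∀ p q → ∣ p - q ∣ ≡ ∣ q - p ∣
  ∣-∣-swap p q = trans (sym (∣-p∣≡∣p∣ (p - q)))
    (cong ∣_∣ (S.solve 2 (λ p q → :- (p :- q) := q :- p) refl p q))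

  ∣∣-bound : ∀ p q → ∣ p ∣ ≤ ∣ q ∣ + ∣ p - q ∣
  ∣∣-bound p q = subst (λ t → ∣ t ∣ ≤ ∣ q ∣ + ∣ p - q ∣)
    (S.solve 2 (λ p q → q :+ (p :- q) := p) refl p q) (∣p+q∣≤∣p∣+∣q∣ q (p - q))

  p≤∣p∣ : ∀ p → p ≤ ∣ p ∣
  p≤∣p∣ p with ≤-total 0ℚ p
  ... | inj₁ 0≤p = ≤-reflexive (sym (0≤p⇒∣p∣≡p 0≤p))
  ... | inj₂ p≤0 = ≤-trans p≤0 (0≤∣p∣ p)

  ∣∣≤ : ∀ {p e} → p ≤ e → - p ≤ e → ∣ p ∣ ≤ e
  ∣∣≤ {p} {e} a b with ∣p∣≡p∨∣p∣≡-p p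
  ... | inj₁ h = subst (_≤ e) (sym h) a
  ... | inj₂ h = subst (_≤ e) (sym h) b

  ∣∣-lipschitz : ∀ p q → ∣ ∣ p ∣ - ∣ q ∣ ∣ ≤ ∣ p - q ∣
  ∣∣-lipschitz p q = ∣∣≤
    (diff-≤ (subst (0ℚ ≤_) (e (∣ p ∣) (∣ q ∣) (∣ p - q ∣)) (≤-diff (∣∣-bound p q))))
    (diff-≤ (subst (0ℚ ≤_) (e′ (∣ p ∣) (∣ q ∣) (∣ p - q ∣))
      (≤-diff (subst (λ t → ∣ q ∣ ≤ ∣ p ∣ + t) (∣-∣-swap q p) (∣∣-bound q p)))))
    where
    e  = S.solve 3 (λ a b c → (b :+ c) :- a := c :- (a :- b)) refl
    e′ = S.solve 3 (λ a b c → (a :+ c) :- b := c :- (:- (a :- b))) refl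

open ℚ-Order

Cauchy : (ℕ → ℚ) → Set
Cauchy x = ∀ ε → 0ℚ < ε → ∃ λ N → ∀ m n → N ℕ.≤ m → N ℕ.≤ n → ∣ x m - x n ∣ ≤ ε

record ℝ : Set where
  constructor real
  field
    seq    : ℕ → ℚ
    cauchy : Cauchy seq

open ℝ public

Eventually : (ℕ → Set) → Set
Eventually P = ∃ λ N → ∀ n → N ℕ.≤ n → P n

infix 4 _<ᴿ_
_<ᴿ_ : ℝ → ℝ → Set
x <ᴿ y = ∃ λ ε → 0ℚ < ε × Eventually (λ n → seq x n + ε ≤ seq y n)

module ℝ-Closure where
  infixr 2 _∩_
  _∩_ : ∀ {P Q : ℕ → Set} → Eventually P → Eventually Q → Eventually (λ n → P n × Q n)
  (M , p) ∩ (N , q) = M ℕ.⊔ N , λ n h →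
    p n (ℕ.≤-trans (ℕ.m≤m⊔n M N) h) , q n (ℕ.≤-trans (ℕ.m≤n⊔m M N) h)

  bounded : ∀ x → ∃ λ B → 0ℚ < B × Eventually (λ n → ∣ seq x n ∣ ≤ B)
  bounded x = let N , h = cauchy x 1ℚ 0<1 in
    ∣ seq x N ∣ + 1ℚ ,
    subst (0ℚ <_) (+-comm 1ℚ (∣ seq x N ∣)) (0<+ 0<1 (0≤∣p∣ (seq x N))) ,
    N , λ n N≤n → ≤-trans (∣∣-bound (seq x n) (seq x N))
                          (+-monoʳ-≤ ∣ seq x N ∣ (h n N N≤n ℕ.≤-refl))

  +-cauchy : ∀ x y → Cauchy (λ n → seq x n + seq y n)
  +-cauchy x y ε 0<ε =
    let M , p = cauchy x (½ * ε) (0<½* 0<ε)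
        N , q = cauchy y (½ * ε) (0<½* 0<ε)
    in M ℕ.⊔ N , λ m n hm hn →
      let a = p m n (ℕ.≤-trans (ℕ.m≤m⊔n M N) hm) (ℕ.≤-trans (ℕ.m≤m⊔n M N) hn)
          b = q m n (ℕ.≤-trans (ℕ.m≤n⊔m M N) hm) (ℕ.≤-trans (ℕ.m≤n⊔m M N) hn)
      in subst₂ _≤_
           (cong ∣_∣ (S.solve 4 (λ a b c d → (a :- c) :+ (b :- d) := (a :+ b) :- (c :+ d)) refl
              (seq x m) (seq y m) (seq x n) (seq y n)))
           (halves ε)
           (≤-trans (∣p+q∣≤∣p∣+∣q∣ (seq x m - seq x n) (seq y m - seq y n)) (+-mono-≤ a b))

  neg-cauchy : ∀ x → Cauchy (λ n → - seq x n)
  neg-cauchy x ε 0<ε = let N , p = cauchy x ε 0<ε in N , λ m n hm hn →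
    subst (_≤ ε)
      (trans (∣-∣-swap (seq x m) (seq x n))
        (cong ∣_∣ (S.solve 2 (λ a b → b :- a := (:- a) :- (:- b)) refl (seq x m) (seq x n))))
      (p m n hm hn)

  abs-cauchy : ∀ x → Cauchy (λ n → ∣ seq x n ∣)
  abs-cauchy x ε 0<ε = let N , p = cauchy x ε 0<ε in N , λ m n hm hn →
    ≤-trans (∣∣-lipschitz (seq x m) (seq x n)) (p m n hm hn)

  *-cauchy : ∀ x y → Cauchy (λ n → seq x n * seq y n)
  *-cauchy x y ε 0<ε =
    let A , 0<A , bx = bounded x
        B , 0<B , by = bounded y
        r , 0<r , eq = recip (A + B) (0<+ 0<A (<⇒≤ 0<B))
        η = r * ε
        M , p = cauchy x η (0<* 0<r 0<ε)
        N , q = cauchy y η (0<* 0<r 0<ε)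
        K , k = bx ∩ by ∩ (M , λ _ h → h) ∩ (N , λ _ h → h)
    in K , λ m n hm hn →
      let am , _ , Mm , Nm = k m hm
          _ , bn , Mn , Nn = k n hn
          a = seq x m ; b = seq y m ; c = seq x n ; d = seq y n
      in subst₂ _≤_
           (cong ∣_∣ (S.solve 4 (λ a b c d → a :* (b :- d) :+ (a :- c) :* d := a :* b :- c :* d)
              refl a b c d))
           (trans (S.solve 4 (λ A B r e → A :* (r :* e) :+ (r :* e) :* B := ((A :+ B) :* r) :* e)
              refl A B r ε)
             (trans (cong (_* ε) eq) (*-identityˡ ε)))
           (≤-trans (∣p+q∣≤∣p∣+∣q∣ (a * (b - d)) ((a - c) * d))
             (+-mono-≤
               (subst (_≤ A * η) (sym (∣p*q∣≡∣p∣*∣q∣ a (b - d)))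
                 (*-mono (0≤∣p∣ a) am (0≤∣p∣ (b - d)) (q m n Nm Nn)))
               (subst (_≤ η * B) (sym (∣p*q∣≡∣p∣*∣q∣ (a - c) d))
                 (*-mono (0≤∣p∣ (a - c)) (p m n Mm Mn) (0≤∣p∣ d) bn))))

open ℝ-Closure

fromℚ : ℚ → ℝ
fromℚ p = real (λ _ → p) λ ε 0<ε → 0 , λ _ _ _ _ →
  subst (λ t → ∣ t ∣ ≤ ε) (sym (+-inverseʳ p)) (<⇒≤ 0<ε)

0ᴿ 1ᴿ : ℝ
0ᴿ = fromℚ 0ℚ
1ᴿ = fromℚ 1ℚ

infixl 6 _+ᴿ_ _-ᴿ_
infixl 7 _*ᴿ_
infixr 8 _^ᴿ_

_+ᴿ_ _-ᴿ_ _*ᴿ_ : ℝ → ℝ → ℝ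
∣_∣ᴿ : ℝ → ℝ

x +ᴿ y = real (λ n → seq x n + seq y n) (+-cauchy x y)
x -ᴿ y = real (λ n → seq x n - seq y n) (+-cauchy x (real (λ n → - seq y n) (neg-cauchy y)))
x *ᴿ y = real (λ n → seq x n * seq y n) (*-cauchy x y)
∣ x ∣ᴿ = real (λ n → ∣ seq x n ∣) (abs-cauchy x)

_^ᴿ_ : ℝ → ℕ → ℝ
x ^ᴿ zero  = 1ᴿ
x ^ᴿ suc n = x *ᴿ x ^ᴿ n

-- Being nonzero means being apart from 0.
infix 4 _#0
_#0 : ℝ → Set
x #0 = 0ᴿ <ᴿ ∣ x ∣ᴿ

-- The value at 0 is irrelevant: a real apart from 0 is represented by a
-- sequence that is eventually nonzero.
inverse₀ : ℚ → ℚ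
inverse₀ p with p ≟ 0ℚ
... | yes _   = 0ℚ
... | no  p≢0 = (1/ p) {{≢-nonZero p≢0}}

module Inverse where
  inverse₀-inverse : ∀ p → p ≢ 0ℚ → p * inverse₀ p ≡ 1ℚ
  inverse₀-inverse p p≢0 with p ≟ 0ℚ
  ... | yes p≡0 = contradiction p≡0 p≢0
  ... | no  p≢0 = *-inverseʳ p {{≢-nonZero p≢0}}

  far≢0 : ∀ {c p} → 0ℚ < c → c ≤ ∣ p ∣ → p ≢ 0ℚ
  far≢0 0<c c≤0 refl = <-irrefl refl (<-≤-trans 0<c c≤0)

  apart : ∀ {x} → x #0 → ∃ λ c → 0ℚ < c × Eventually (λ n → c ≤ ∣ seq x n ∣)
  apart {x} (c , 0<c , N , h) = c , 0<c , N , λ n hn →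
    subst (_≤ ∣ seq x n ∣) (+-identityˡ c) (h n hn)

  apart⁻¹ : ∀ {x} → (∃ λ c → 0ℚ < c × Eventually (λ n → c ≤ ∣ seq x n ∣)) → x #0
  apart⁻¹ {x} (c , 0<c , N , h) = c , 0<c , N , λ n hn →
    subst (_≤ ∣ seq x n ∣) (sym (+-identityˡ c)) (h n hn)

  inverse-cauchy : ∀ x → x #0 → Cauchy (λ n → inverse₀ (seq x n))
  inverse-cauchy x x#0 ε 0<ε =
    let c , 0<c , far = apart {x} x#0
        r , 0<r , eq  = recip c 0<c
        N , p = cauchy x (c * c * ε) (0<* (0<* 0<c 0<c) 0<ε)
        K , k = far ∩ (N , λ _ h → h)
    in K , λ m n hm hn →
      let ca , Nm = k m hm
          cb , Nn = k n hn
          a = seq x m ; b = seq x n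
          i = inverse₀ a ; j = inverse₀ b
          ai = inverse₀-inverse a (far≢0 0<c ca)
          bj = inverse₀-inverse b (far≢0 0<c cb)
          small : ∀ {a i} → c ≤ ∣ a ∣ → a * i ≡ 1ℚ → ∣ i ∣ ≤ r
          small {a} {i} ca ai = subst₂ _≤_
            (trans (S.solve 3 (λ r c u → r :* (c :* u) := (c :* r) :* u) refl r c (∣ i ∣))
              (trans (cong (_* ∣ i ∣) eq) (*-identityˡ ∣ i ∣)))
            (trans (cong (r *_) (trans (sym (∣p*q∣≡∣p∣*∣q∣ a i)) (cong ∣_∣ ai))) (*-identityʳ r))
            (*-monoˡ-≤-nonNeg r {{nonNegative (<⇒≤ 0<r)}}
              (*-monoʳ-≤-nonNeg ∣ i ∣ {{nonNegative (0≤∣p∣ i)}} ca))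
          i-j : (b - a) * (i * j) ≡ i - j
          i-j = trans (S.solve 4 (λ a b i j → (b :- a) :* (i :* j) := i :* (b :* j) :- j :* (a :* i))
                        refl a b i j)
                  (cong₂ (λ s t → s - t) (trans (cong (i *_) bj) (*-identityʳ i))
                                          (trans (cong (j *_) ai) (*-identityʳ j)))
          ∣i-j∣ : ∣ b - a ∣ * (∣ i ∣ * ∣ j ∣) ≡ ∣ i - j ∣
          ∣i-j∣ = trans (cong (∣ b - a ∣ *_) (sym (∣p*q∣≡∣p∣*∣q∣ i j)))
                  (trans (sym (∣p*q∣≡∣p∣*∣q∣ (b - a) (i * j))) (cong ∣_∣ i-j))
      in subst₂ _≤_ ∣i-j∣
           (trans (S.solve 3 (λ c r e → c :* c :* e :* (r :* r) := (c :* r) :* ((c :* r) :* e))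
                     refl c r ε)
             (trans (cong (λ t → t * (t * ε)) eq)
               (trans (*-identityˡ _) (*-identityˡ ε))))
           (*-mono (0≤∣p∣ (b - a)) (p n m Nn Nm) (0≤* (0≤∣p∣ i) (0≤∣p∣ j))
             (*-mono (0≤∣p∣ i) (small ca ai) (0≤∣p∣ j) (small cb bj)))

open Inverse

inverse : (x : ℝ) → x #0 → ℝ
inverse x x#0 = real (λ n → inverse₀ (seq x n)) (inverse-cauchy x x#0)

inverse-#0 : ∀ x (x#0 : x #0) → inverse x x#0 #0
inverse-#0 x x#0 =
  let c , 0<c , far = apart {x} x#0
      B , 0<B , bd  = bounded x
      r , 0<r , eq  = recip B 0<B
      K , k = far ∩ bd
  in apart⁻¹ {inverse x x#0} (r , 0<r , K , λ n hn →
    let cx , xB = k n hn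
        a = seq x n ; i = inverse₀ a
        ai = inverse₀-inverse a (far≢0 0<c cx)
    in subst₂ _≤_
         (trans (cong (r *_) (trans (sym (∣p*q∣≡∣p∣*∣q∣ a i)) (cong ∣_∣ ai))) (*-identityʳ r))
         (trans (S.solve 3 (λ r B u → r :* (B :* u) := (B :* r) :* u) refl r B (∣ i ∣))
           (trans (cong (_* ∣ i ∣) eq) (*-identityˡ ∣ i ∣)))
         (*-monoˡ-≤-nonNeg r {{nonNegative (<⇒≤ 0<r)}}
           (*-monoʳ-≤-nonNeg ∣ i ∣ {{nonNegative (0≤∣p∣ i)}} xB)))

*-#0 : ∀ x y → x #0 → y #0 → x *ᴿ y #0
*-#0 x y x#0 y#0 =
  let c , 0<c , p = apart {x} x#0
      d , 0<d , q = apart {y} y#0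
      K , k = p ∩ q
  in apart⁻¹ {x *ᴿ y} (c * d , 0<* 0<c 0<d , K , λ n hn →
    let a , b = k n hn in
    subst (c * d ≤_) (sym (∣p*q∣≡∣p∣*∣q∣ (seq x n) (seq y n)))
      (*-mono (<⇒≤ 0<c) a (<⇒≤ 0<d) b))

^-#0 : ∀ x n → x #0 → x ^ᴿ n #0
^-#0 x zero    _   = apart⁻¹ {1ᴿ} (1ℚ , 0<1 , 0 , λ _ _ → ≤-refl)
^-#0 x (suc n) x#0 = *-#0 x (x ^ᴿ n) x#0 (^-#0 x n x#0)

fromℚ-#0 : ∀ p → 0ℚ < p → fromℚ p #0
fromℚ-#0 p 0<p = apart⁻¹ {fromℚ p} (p , 0<p , 0 , λ _ _ → p≤∣p∣ p)

1-z#0 : ∀ z → ∣ z ∣ᴿ <ᴿ 1ᴿ → 1ᴿ -ᴿ z #0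
1-z#0 z (ε , 0<ε , N , h) = apart⁻¹ {1ᴿ -ᴿ z} (ε , 0<ε , N , λ n hn →
  ≤-trans
    (diff-≤ (subst (0ℚ ≤_)
      (S.solve 3 (λ u e a → u :- (a :+ e) := (u :- a) :- e) refl 1ℚ ε (seq z n))
      (≤-diff (≤-trans (+-monoˡ-≤ ε (p≤∣p∣ (seq z n))) (h n hn)))))
    (p≤∣p∣ (1ℚ - seq z n)))

sumToᴿ : ((n : ℕ) .{{_ : ℕ.NonZero n}} → ℝ) → ℕ → ℝ
sumToᴿ = sumTo _+ᴿ_ 0ᴿ

powerSeries : (ℕ → ℕ) → ℝ → (n : ℕ) .{{_ : ℕ.NonZero n}} → ℝ
powerSeries a z n = fromℚ (fromℕ (a n)) *ᴿ z ^ᴿ n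

HasSum : ((n : ℕ) .{{_ : ℕ.NonZero n}} → ℝ) → ℝ → Set
HasSum a ℓ = ∀ ε → 0ℚ < ε → Eventually (λ M → ∣ sumToᴿ a M -ᴿ ℓ ∣ᴿ <ᴿ fromℚ ε)

module Convergence where

  record Tame (a : ℕ → ℕ) : Set where
    constructor tame
    field bound : ∀ r → 0ℚ < r → r < 1ℚ → ∃ λ B → 0ℚ < B × (∀ n → fromℕ (a n) * r ^ n ≤ B)
  open Tame

  toℚᵘ-fromℕ : ∀ n → toℚᵘ (fromℕ n) ℚᵘ.≃ ℚᵘ.mkℚᵘ (+ n) 0
  toℚᵘ-fromℕ n = toℚᵘ-fromℚᵘ (ℚᵘ.mkℚᵘ (+ n) 0)

  fromℕ-+ : ∀ m n → fromℕ (m ℕ.+ n) ≡ fromℕ m + fromℕ n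
  fromℕ-+ m n = toℚᵘ-injective (begin
    toℚᵘ (fromℕ (m ℕ.+ n))                    ≈⟨ toℚᵘ-fromℕ (m ℕ.+ n) ⟩
    ℚᵘ.mkℚᵘ (+ (m ℕ.+ n)) 0                   ≈⟨ ℚᵘ.*≡* (cong (ℤ._* + 1)
      (trans (ℤ.pos-+ m n) (sym (cong₂ ℤ._+_ (ℤ.*-identityʳ (+ m)) (ℤ.*-identityʳ (+ n)))))) ⟩
    ℚᵘ.mkℚᵘ (+ m) 0 ℚᵘ.+ ℚᵘ.mkℚᵘ (+ n) 0      ≈⟨ ℚᵘ.+-cong (toℚᵘ-fromℕ m) (toℚᵘ-fromℕ n) ⟨
    toℚᵘ (fromℕ m) ℚᵘ.+ toℚᵘ (fromℕ n)        ≈⟨ toℚᵘ-homo-+ (fromℕ m) (fromℕ n) ⟨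
    toℚᵘ (fromℕ m + fromℕ n)                  ∎)
    where open ℚᵘ.≃-Reasoning

  fromℕ-* : ∀ m n → fromℕ (m ℕ.* n) ≡ fromℕ m * fromℕ n
  fromℕ-* m n = toℚᵘ-injective (begin
    toℚᵘ (fromℕ (m ℕ.* n))                    ≈⟨ toℚᵘ-fromℕ (m ℕ.* n) ⟩
    ℚᵘ.mkℚᵘ (+ (m ℕ.* n)) 0                   ≈⟨ ℚᵘ.*≡* (cong (ℤ._* + 1) (ℤ.pos-* m n)) ⟩
    ℚᵘ.mkℚᵘ (+ m) 0 ℚᵘ.* ℚᵘ.mkℚᵘ (+ n) 0      ≈⟨ ℚᵘ.*-cong (toℚᵘ-fromℕ m) (toℚᵘ-fromℕ n) ⟨
    toℚᵘ (fromℕ m) ℚᵘ.* toℚᵘ (fromℕ n)        ≈⟨ toℚᵘ-homo-* (fromℕ m) (fromℕ n) ⟨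
    toℚᵘ (fromℕ m * fromℕ n)                  ∎)
    where open ℚᵘ.≃-Reasoning

  0≤fromℕ : ∀ n → 0ℚ ≤ fromℕ n
  0≤fromℕ n = nonNegative⁻¹ (fromℕ n) {{normalize-nonNeg n 1}}

  0<fromℕ : ∀ n .{{_ : ℕ.NonZero n}} → 0ℚ < fromℕ n
  0<fromℕ n = positive⁻¹ (fromℕ n) {{normalize-pos n 1}}

  fromℕ-suc : ∀ n → fromℕ (suc n) ≡ 1ℚ + fromℕ n
  fromℕ-suc n = fromℕ-+ 1 n

  fromℕ-mono : ∀ {m n} → m ℕ.≤ n → fromℕ m ≤ fromℕ n
  fromℕ-mono {m} {n} m≤n = subst₂ _≤_ (+-identityʳ (fromℕ m))
    (trans (sym (fromℕ-+ m (n ℕ.∸ m))) (cong fromℕ (ℕ.m+[n∸m]≡n m≤n)))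
    (+-monoʳ-≤ (fromℕ m) (0≤fromℕ (n ℕ.∸ m)))

  archimedean : ∀ p → ∃ λ n → p ≤ fromℕ n
  archimedean p@(mkℚ i d _) = ℤ.∣ i ∣ , toℚᵘ-cancel-≤ (ℚᵘ.≤-trans
    (ℚᵘ.*≤* (ℤ.≤-trans (ℤ.≤-trans (ℤ.≤-reflexive (ℤ.*-identityʳ i)) (i≤∣i∣ i))
      (ℤ.≤-trans (ℤ.≤-reflexive (sym (ℤ.*-identityʳ (+ ℤ.∣ i ∣))))
        (ℤ.*-monoˡ-≤-nonNeg (+ ℤ.∣ i ∣) (ℤ.+≤+ (ℕ.s≤s ℕ.z≤n))))))
    (ℚᵘ.≤-reflexive (ℚᵘ.≃-sym (toℚᵘ-fromℕ ℤ.∣ i ∣))))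
    where
    i≤∣i∣ : ∀ i → i ℤ.≤ + ℤ.∣ i ∣
    i≤∣i∣ (+ n)       = ℤ.≤-refl
    i≤∣i∣ ℤ.-[1+ n ] = ℤ.-≤+

  0<^ : ∀ {r} n → 0ℚ < r → 0ℚ < r ^ n
  0<^ zero    0<r = 0<1
  0<^ (suc n) 0<r = 0<* 0<r (0<^ n 0<r)

  ^-distrib-* : ∀ x q n → (x * q) ^ n ≡ x ^ n * q ^ n
  ^-distrib-* x q zero    = refl
  ^-distrib-* x q (suc n) = trans (cong (x * q *_) (^-distrib-* x q n))
    (S.solve 4 (λ x q a b → x :* q :* (a :* b) := x :* a :* (q :* b)) refl x q (x ^ n) (q ^ n))

  bernoulli : ∀ x → 0ℚ < x → x < 1ℚ → ∀ n → (1ℚ + fromℕ n * (1ℚ - x)) * x ^ n ≤ 1ℚ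
  bernoulli x 0<x x<1 zero    = ≤-reflexive (trans (*-identityʳ _)
    (trans (cong (λ t → 1ℚ + t) (*-zeroˡ (1ℚ - x))) (+-identityʳ 1ℚ)))
  bernoulli x 0<x x<1 (suc n) = ≤-trans
    (subst (_≤ (1ℚ + fromℕ n * d) * x ^ n)
      (S.solve 3 (λ k u y → (k :* u) :* y := k :* (u :* y)) refl (1ℚ + fromℕ (suc n) * d) x (x ^ n))
      (*-monoʳ-≤-nonNeg (x ^ n) {{nonNegative (<⇒≤ (0<^ n 0<x))}} step))
    (bernoulli x 0<x x<1 n)
    where
    d = 1ℚ - x
    step : (1ℚ + fromℕ (suc n) * d) * x ≤ 1ℚ + fromℕ n * d
    step = diff-≤ (subst (0ℚ ≤_)
      (trans (S.solve 2 (λ m x → (con 1ℚ :+ m) :* ((con 1ℚ :- x) :* (con 1ℚ :- x)) :=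
          (con 1ℚ :+ m :* (con 1ℚ :- x)) :-
          (con 1ℚ :+ (con 1ℚ :+ m) :* (con 1ℚ :- x)) :* x) refl (fromℕ n) x)
        (cong (λ t → (1ℚ + fromℕ n * d) - (1ℚ + t * d) * x) (sym (fromℕ-suc n))))
      (0≤* (0≤+ (<⇒≤ 0<1) (0≤fromℕ n))
           (0≤* (<⇒≤ (<-diff x<1)) (<⇒≤ (<-diff x<1)))))

  nxⁿ-bounded : ∀ x → 0ℚ < x → x < 1ℚ → ∃ λ D → 0ℚ < D × (∀ n → fromℕ n * x ^ n ≤ D)
  nxⁿ-bounded x 0<x x<1 with recip (1ℚ - x) (<-diff x<1)
  ... | D , 0<D , eq = D , 0<D , λ n →
    let d = 1ℚ - x
        y = x ^ n
        le : fromℕ n * d * y ≤ 1ℚ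
        le = ≤-trans
          (subst (_≤ (1ℚ + fromℕ n * d) * y) (+-identityˡ _)
            (≤-trans (+-monoˡ-≤ (fromℕ n * d * y) (<⇒≤ (0<^ n 0<x)))
              (≤-reflexive (S.solve 2 (λ a y → y :+ a :* y := (con 1ℚ :+ a) :* y) refl
                (fromℕ n * d) y))))
          (bernoulli x 0<x x<1 n)
    in subst₂ _≤_
         (trans (S.solve 4 (λ m d y D → D :* (m :* d :* y) := (d :* D) :* (m :* y)) refl
             (fromℕ n) d y D)
           (trans (cong (_* (fromℕ n * y)) eq) (*-identityˡ _)))
         (*-identityʳ D)
         (*-monoˡ-≤-nonNeg D {{nonNegative (<⇒≤ 0<D)}} le)

  split : ∀ r → 0ℚ < r → r < 1ℚ →
          ∃ λ x → ∃ λ q → (0ℚ < x × x < 1ℚ) × (0ℚ < q × q < 1ℚ) × r ≡ x * q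
  split r 0<r r<1 with <-dense r<1
  ... | q , r<q , q<1 with recip q (<-trans 0<r r<q)
  ...   | i , 0<i , eq = r * i , q ,
    (0<* 0<r 0<i , subst (r * i <_) eq (*-monoˡ-<-pos′ r<q)) ,
    (<-trans 0<r r<q , q<1) ,
    trans (sym (*-identityʳ r)) (trans (cong (r *_) (sym eq))
      (S.solve 3 (λ r q i → r :* (q :* i) := r :* i :* q) refl r q i))
    where
    *-monoˡ-<-pos′ : r < q → r * i < q * i
    *-monoˡ-<-pos′ = *-monoˡ-<-pos i {{positive 0<i}}

  gain : ∀ (a : ℕ → ℕ) → (∀ q → 0ℚ < q → q < 1ℚ →
         ∃ λ B → 0ℚ < B × (∀ n → fromℕ (a n) * q ^ n ≤ fromℕ n * B)) → Tame a
  gain a h = tame λ r 0<r r<1 →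
    let x , q , (0<x , x<1) , (0<q , q<1) , eq = split r 0<r r<1
        B , 0<B , hB = h q 0<q q<1
        D , 0<D , hD = nxⁿ-bounded x 0<x x<1
    in D * B , 0<* 0<D 0<B , λ n →
      subst (λ t → fromℕ (a n) * t ≤ D * B)
        (sym (trans (cong (_^ n) eq) (^-distrib-* x q n)))
        (combine (fromℕ (a n)) (x ^ n) (q ^ n) (fromℕ n) B D
          (<⇒≤ (0<^ n 0<x)) (<⇒≤ 0<B) (hB n) (hD n))
    where
    combine : ∀ A X Q m B D → 0ℚ ≤ X → 0ℚ ≤ B → A * Q ≤ m * B → m * X ≤ D → A * (X * Q) ≤ D * B
    combine A X Q m B D 0≤X 0≤B h₁ h₂ = ≤-trans
      (subst₂ _≤_ (S.solve 3 (λ A X Q → A :* Q :* X := A :* (X :* Q)) refl A X Q)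
                  (S.solve 3 (λ m B X → m :* B :* X := m :* X :* B) refl m B X)
        (*-monoʳ-≤-nonNeg X {{nonNegative 0≤X}} h₁))
      (*-monoʳ-≤-nonNeg B {{nonNegative 0≤B}} h₂)

  r^n≤1 : ∀ r → 0ℚ < r → r < 1ℚ → ∀ n → r ^ n ≤ 1ℚ
  r^n≤1 r 0<r r<1 zero    = ≤-refl
  r^n≤1 r 0<r r<1 (suc n) = subst (r * r ^ n ≤_) (*-identityʳ 1ℚ)
    (*-mono (<⇒≤ 0<r) (<⇒≤ r<1) (<⇒≤ (0<^ n 0<r)) (r^n≤1 r 0<r r<1 n))

  tame-1 : Tame (λ _ → 1)
  tame-1 = tame λ r 0<r r<1 → 1ℚ , 0<1 , λ n → subst (_≤ 1ℚ) (sym (*-identityˡ (r ^ n))) (r^n≤1 r 0<r r<1 n)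

  tame-n : ∀ {a} → Tame a → Tame (λ n → n ℕ.* a n)
  tame-n {a} t = gain (λ n → n ℕ.* a n) λ q 0<q q<1 → let B , 0<B , hB = bound t q 0<q q<1 in B , 0<B , λ n →
    subst (_≤ fromℕ n * B)
      (trans (sym (*-assoc (fromℕ n) (fromℕ (a n)) (q ^ n)))
        (cong (_* q ^ n) (sym (fromℕ-* n (a n)))))
      (*-monoˡ-≤-nonNeg (fromℕ n) {{nonNegative (0≤fromℕ n)}} (hB n))

  tame-n^ : ∀ {a} s → Tame a → Tame (λ n → n ℕ.^ s ℕ.* a n)
  tame-n^ {a} zero    t = tame λ r 0<r r<1 → let B , 0<B , hB = bound t r 0<r r<1 in B , 0<B , λ n →
    subst (λ k → fromℕ k * r ^ n ≤ B) (sym (ℕ.*-identityˡ (a n))) (hB n)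
  tame-n^ {a} (suc s) t = tame λ r 0<r r<1 →
    let B , 0<B , hB = bound (tame-n (tame-n^ s t)) r 0<r r<1 in B , 0<B , λ n →
    subst (λ k → fromℕ k * r ^ n ≤ B) (sym (ℕ.*-assoc n (n ℕ.^ s) (a n))) (hB n)

  tame-pred : ∀ {a} → Tame a → Tame (λ n → a (pred n))
  tame-pred {a} t = tame λ r 0<r r<1 → let B , 0<B , hB = bound t r 0<r r<1 in B , 0<B , λ
    { zero    → hB zero
    ; (suc n) → ≤-trans
        (subst₂ _≤_
          (S.solve 3 (λ a r p → a :* p :* r := a :* (r :* p)) refl (fromℕ (a n)) r (r ^ n))
          (*-identityʳ (fromℕ (a n) * r ^ n))
          (*-monoˡ-≤-nonNeg (fromℕ (a n) * r ^ n)
            {{nonNegative (0≤* (0≤fromℕ (a n)) (<⇒≤ (0<^ n 0<r)))}} (<⇒≤ r<1)))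
        (hB n) }

  tame-sum : ∀ {a} → Tame a → Tame (sumTo ℕ._+_ 0 (λ n → a n))
  tame-sum {a} t = gain (sumTo ℕ._+_ 0 (λ n → a n)) λ q 0<q q<1 →
    let B , 0<B , hB = bound t q 0<q q<1 in B , 0<B , λ n → bound′ q 0<q q<1 B hB n
    where
    bound′ : ∀ q → 0ℚ < q → q < 1ℚ → ∀ B → (∀ n → fromℕ (a n) * q ^ n ≤ B) →
            ∀ n → fromℕ (sumTo ℕ._+_ 0 (λ n → a n) n) * q ^ n ≤ fromℕ n * B
    bound′ q 0<q q<1 B hB zero    = ≤-reflexive (trans (*-zeroˡ (q ^ 0)) (sym (*-zeroˡ B)))
    bound′ q 0<q q<1 B hB (suc n) = subst₂ _≤_
      (trans (S.solve 4 (λ A q p c → A :* (q :* p) :+ c :* (q :* p) := (A :+ c) :* (q :* p)) refl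
          (fromℕ A) q (q ^ n) (fromℕ (a (suc n))))
        (cong (_* q ^ suc n) (sym (fromℕ-+ A (a (suc n))))))
      (trans (S.solve 2 (λ m B → m :* B :+ B := (con 1ℚ :+ m) :* B) refl (fromℕ n) B)
        (cong (_* B) (sym (fromℕ-suc n))))
      (+-mono-≤
        (≤-trans
          (subst₂ _≤_
            (S.solve 3 (λ a r p → a :* p :* r := a :* (r :* p)) refl (fromℕ A) q (q ^ n))
            (*-identityʳ (fromℕ A * q ^ n))
            (*-monoˡ-≤-nonNeg (fromℕ A * q ^ n)
              {{nonNegative (0≤* (0≤fromℕ A) (<⇒≤ (0<^ n 0<q)))}} (<⇒≤ q<1)))
          (bound′ q 0<q q<1 B hB n))
        (hB (suc n)))
      where A = sumTo ℕ._+_ 0 (λ n → a n) n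

  tame-H : ∀ w → Tame (H w)
  tame-summand : ∀ s w → Tame (summand s w)
  tame-H []      = tame-1
  tame-H (s ∷ w) = tame-sum (tame-summand s w)
  tame-summand s w = tame-n^ s (tame-pred (tame-H w))

  partial : (ℕ → ℕ) → ℚ → ℕ → ℚ
  partial a x = sumTo _+_ 0ℚ (λ n → fromℕ (a n) * x ^ n)

  ∣^∣≤ : ∀ {x r} → ∣ x ∣ ≤ r → ∀ n → ∣ x ^ n ∣ ≤ r ^ n
  ∣^∣≤ h zero        = ≤-refl
  ∣^∣≤ {x} {r} h (suc n) = subst (_≤ r ^ suc n) (sym (∣p*q∣≡∣p∣*∣q∣ x (x ^ n)))
    (*-mono (0≤∣p∣ x) h (0≤∣p∣ (x ^ n)) (∣^∣≤ h n))

  -- If |a n xⁿ| ≤ B yⁿ, then (1 - y) |a (M + 1) x^{M + 1} + ⋯ + a (M + j) x^{M + j}| ≤ B y^M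
  geometric : ∀ a x y B → 0ℚ < y → y < 1ℚ → 0ℚ < B → (∀ n → ∣ fromℕ (a n) * x ^ n ∣ ≤ B * y ^ n) →
    ∀ M j → ∣ partial a x (j ℕ.+ M) - partial a x M ∣ * (1ℚ - y) ≤ B * y ^ M
  geometric a x y B 0<y y<1 0<B term≤ M j = ≤-trans (grow _ (B * y ^ (j ℕ.+ M))
      (0≤* (<⇒≤ 0<B) (<⇒≤ (0<^ (j ℕ.+ M) 0<y)))) (invariant j)
    where
    0≤d : 0ℚ ≤ 1ℚ - y
    0≤d = <⇒≤ (<-diff y<1)

    grow : ∀ p q → 0ℚ ≤ q → p ≤ p + q
    grow p q 0≤q = subst (_≤ p + q) (+-identityʳ p) (+-monoʳ-≤ p 0≤q)

    base : ∀ P Y → ∣ P - P ∣ * (1ℚ - y) + B * Y ≤ B * Y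
    base P Y = ≤-reflexive (trans (cong (λ t → ∣ t ∣ * (1ℚ - y) + B * Y) (+-inverseʳ P))
      (trans (cong (_+ B * Y) (*-zeroˡ (1ℚ - y))) (+-identityˡ _)))

    step : ∀ P c Q Y → 0ℚ ≤ Y → ∣ c ∣ ≤ B * (y * Y) →
           ∣ (P + c) - Q ∣ * (1ℚ - y) + B * (y * Y) ≤ ∣ P - Q ∣ * (1ℚ - y) + B * Y
    step P c Q Y 0≤Y hc = ≤-trans
      (+-monoˡ-≤ (B * (y * Y)) (*-monoʳ-≤-nonNeg (1ℚ - y) {{nonNegative 0≤d}}
        (≤-trans
          (subst (λ t → ∣ t ∣ ≤ ∣ P - Q ∣ + ∣ c ∣)
            (S.solve 3 (λ P c Q → (P :- Q) :+ c := (P :+ c) :- Q) refl P c Q)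
            (∣p+q∣≤∣p∣+∣q∣ (P - Q) c))
          (+-monoʳ-≤ (∣ P - Q ∣) hc))))
      (diff-≤ (subst (0ℚ ≤_)
        (S.solve 4 (λ T B Y y →
            B :* Y :* ((con 1ℚ :- y) :* (con 1ℚ :- y)) :=
            (T :* (con 1ℚ :- y) :+ B :* Y) :-
            ((T :+ B :* (y :* Y)) :* (con 1ℚ :- y) :+ B :* (y :* Y))) refl (∣ P - Q ∣) B Y y)
        (0≤* (0≤* (<⇒≤ 0<B) 0≤Y) (0≤* 0≤d 0≤d))))

    invariant : ∀ j →
      ∣ partial a x (j ℕ.+ M) - partial a x M ∣ * (1ℚ - y) + B * y ^ (j ℕ.+ M) ≤ B * y ^ M
    invariant zero    = base (partial a x M) (y ^ M)
    invariant (suc j) = ≤-trans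
      (step (partial a x (j ℕ.+ M)) (fromℕ (a (suc j ℕ.+ M)) * x ^ (suc j ℕ.+ M)) (partial a x M)
        (y ^ (j ℕ.+ M)) (<⇒≤ (0<^ (j ℕ.+ M) 0<y)) (term≤ (suc j ℕ.+ M)))
      (invariant j)

  tail : ∀ {a} → Tame a → ∀ r → 0ℚ < r → r < 1ℚ → ∀ ε → 0ℚ < ε →
         ∃ λ M₀ → ∀ M j → M₀ ℕ.≤ M → ∀ x → ∣ x ∣ ≤ r →
         ∣ partial a x (j ℕ.+ M) - partial a x M ∣ ≤ ε
  tail {a} t r 0<r r<1 ε 0<ε =
    let y , q , (0<y , y<1) , (0<q , q<1) , eq = split r 0<r r<1
        B , 0<B , hB = bound t q 0<q q<1
        C , 0<C , hC = nxⁿ-bounded y 0<y y<1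
        D , 0<D , eqD = recip (1ℚ - y) (<-diff y<1)
        E , 0<E , eqE = recip ε 0<ε
        K , hK = archimedean (C * (B * D) * E)
    in suc K , λ M j K<M x x≤r →
      small M (<⇒≤ 0<B) 0<D eqD eqE
        (ℕ.<-≤-trans (ℕ.s≤s ℕ.z≤n) K<M) (hC M)
        (≤-trans hK (fromℕ-mono (ℕ.≤-trans (ℕ.n≤1+n K) K<M)))
        (geometric a x y B 0<y y<1 0<B
          (λ n → term≤ (a n) (y ^ n) (<⇒≤ (0<^ n 0<y)) (hB n)
            (subst (∣ x ^ n ∣ ≤_) (trans (cong (_^ n) eq) (^-distrib-* y q n)) (∣^∣≤ x≤r n)))
          M j)
    where
    term≤ : ∀ k {X} Y {Q B} → 0ℚ ≤ Y → fromℕ k * Q ≤ B → ∣ X ∣ ≤ Y * Q → ∣ fromℕ k * X ∣ ≤ B * Y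
    term≤ k {X} Y {Q} {B} 0≤Y hB hX = subst (_≤ B * Y) (sym (∣p*q∣≡∣p∣*∣q∣ (fromℕ k) X))
      (≤-trans
        (subst (λ t → t * ∣ X ∣ ≤ fromℕ k * (Y * Q)) (sym (0≤p⇒∣p∣≡p (0≤fromℕ k)))
          (*-monoˡ-≤-nonNeg (fromℕ k) {{nonNegative (0≤fromℕ k)}} hX))
        (subst (_≤ B * Y) (S.solve 3 (λ k Y Q → k :* Q :* Y := k :* (Y :* Q)) refl (fromℕ k) Y Q)
          (*-monoʳ-≤-nonNeg Y {{nonNegative 0≤Y}} hB)))

    combine : ∀ m T d Y B C D E → 0ℚ < m → 0ℚ ≤ B → 0ℚ < D → d * D ≡ 1ℚ → ε * E ≡ 1ℚ →
      m * Y ≤ C → C * (B * D) * E ≤ m → T * d ≤ B * Y → T ≤ ε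
    combine m T d Y B C D E 0<m 0≤B 0<D eqD eqE hC hK hT =
      *-cancelˡ-≤-pos m {{positive 0<m}} (≤-trans (*-monoˡ-≤-nonNeg m {{nonNegative (<⇒≤ 0<m)}} T≤)
        (≤-trans mD≤ ≤mε))
      where
      T≤ : T ≤ D * (B * Y)
      T≤ = subst (_≤ D * (B * Y))
        (trans (S.solve 3 (λ D d T → D :* (T :* d) := (d :* D) :* T) refl D d T)
          (trans (cong (_* T) eqD) (*-identityˡ T)))
        (*-monoˡ-≤-nonNeg D {{nonNegative (<⇒≤ 0<D)}} hT)
      mD≤ : m * (D * (B * Y)) ≤ C * (B * D)
      mD≤ = subst (_≤ C * (B * D))
        (S.solve 4 (λ m Y B D → m :* Y :* (B :* D) := m :* (D :* (B :* Y))) refl m Y B D)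
        (*-monoʳ-≤-nonNeg (B * D) {{nonNegative (0≤* 0≤B (<⇒≤ 0<D))}} hC)
      ≤mε : C * (B * D) ≤ m * ε
      ≤mε = subst (_≤ m * ε)
        (trans (S.solve 3 (λ c e i → c :* i :* e := c :* (e :* i)) refl (C * (B * D)) ε E)
          (trans (cong (C * (B * D) *_) eqE) (*-identityʳ _)))
        (*-monoʳ-≤-nonNeg ε {{nonNegative (<⇒≤ 0<ε)}} hK)

    small : ∀ M {T d Y B C D E} → 0ℚ ≤ B → 0ℚ < D → d * D ≡ 1ℚ → ε * E ≡ 1ℚ →
      0 ℕ.< M → fromℕ M * Y ≤ C → C * (B * D) * E ≤ fromℕ M → T * d ≤ B * Y → T ≤ ε
    small (suc M) {T} {d} {Y} {B} {C} {D} {E} 0≤B 0<D eqD eqE _ =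
      combine (fromℕ (suc M)) T d Y B C D E (0<fromℕ (suc M)) 0≤B 0<D eqD eqE

  seq-^ : ∀ z n k → seq (z ^ᴿ n) k ≡ seq z k ^ n
  seq-^ z zero    k = refl
  seq-^ z (suc n) k = cong (seq z k *_) (seq-^ z n k)

  seq-partial : ∀ a z M k → seq (sumToᴿ (powerSeries a z) M) k ≡ partial a (seq z k) M
  seq-partial a z zero    k = refl
  seq-partial a z (suc M) k =
    cong₂ _+_ (seq-partial a z M k) (cong (fromℕ (a (suc M)) *_) (seq-^ z (suc M) k))

  radius : ∀ z → ∣ z ∣ᴿ <ᴿ 1ᴿ →
           ∃ λ r → 0ℚ < r × r < 1ℚ × Eventually (λ k → ∣ seq z k ∣ ≤ r)
  radius z (ε , 0<ε , N , h) with <-dense (<-≤-trans 1-ε<1 ≤-refl)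
    where
    1-ε<1 : 1ℚ - ε < 1ℚ
    1-ε<1 = subst (1ℚ - ε <_) (+-identityʳ 1ℚ) (+-monoʳ-< 1ℚ (neg-antimono-< 0<ε))
  ... | r , 1-ε<r , r<1 = r , ≤-<-trans (≤-trans (0≤∣p∣ (seq z N)) (le N ℕ.≤-refl)) 1-ε<r , r<1 ,
    N , λ k hk → ≤-trans (le k hk) (<⇒≤ 1-ε<r)
    where
    le : ∀ k → N ℕ.≤ k → ∣ seq z k ∣ ≤ 1ℚ - ε
    le k hk = subst (_≤ 1ℚ - ε)
      (S.solve 2 (λ a e → (a :+ e) :- e := a) refl (∣ seq z k ∣) ε) (+-monoˡ-≤ (- ε) (h k hk))

  diagonal-cauchy : ∀ {a} → Tame a → ∀ z → ∣ z ∣ᴿ <ᴿ 1ᴿ → Cauchy (λ k → partial a (seq z k) k)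
  diagonal-cauchy {a} t z ∣z∣<1 ε 0<ε =
    let r , 0<r , r<1 , N , hN = radius z ∣z∣<1
        η = ½ * (½ * ε)
        0<η = 0<½* (0<½* 0<ε)
        M₀ , hM = tail t r 0<r r<1 η 0<η
        K , hK = cauchy (sumToᴿ (powerSeries a z) M₀) (½ * ε) (0<½* 0<ε)
        P = λ k → partial a (seq z k)
        far : ∀ k → M₀ ℕ.≤ k → N ℕ.≤ k → ∣ P k k - P k M₀ ∣ ≤ η
        far k M₀≤k N≤k = subst (λ i → ∣ P k i - P k M₀ ∣ ≤ η) (ℕ.m∸n+n≡m M₀≤k)
          (hM M₀ (k ℕ.∸ M₀) ℕ.≤-refl (seq z k) (hN k N≤k))
        L , hL = (M₀ , λ _ h → h) ∩ (N , λ _ h → h) ∩ (K , λ _ h → h)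
    in L , λ m n hm hn →
      let m₁ , m₂ , m₃ = hL m hm
          n₁ , n₂ , n₃ = hL n hn
      in ≤-trans (∣-∣-triangle (P m m) (P m M₀) (P n n))
        (subst (∣ P m m - P m M₀ ∣ + ∣ P m M₀ - P n n ∣ ≤_)
          (trans (cong (λ t → η + (½ * ε + t)) refl)
            (trans (S.solve 2 (λ e h → e :+ (h :+ e) := (e :+ e) :+ h) refl η (½ * ε))
              (trans (cong (_+ ½ * ε) (halves (½ * ε))) (halves ε))))
          (+-mono-≤ (far m m₁ m₂)
            (≤-trans (∣-∣-triangle (P m M₀) (P n M₀) (P n n))
              (+-mono-≤
                (subst₂ (λ s t → ∣ s - t ∣ ≤ ½ * ε) (seq-partial a z M₀ m) (seq-partial a z M₀ n)
                  (hK m n m₃ n₃))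
                (subst (_≤ η) (∣-∣-swap (P n n) (P n M₀)) (far n n₁ n₂))))))

  powerSeries-sum : ∀ {a} → Tame a → ∀ z → ∣ z ∣ᴿ <ᴿ 1ᴿ → ∃ (HasSum (powerSeries a z))
  powerSeries-sum {a} t z ∣z∣<1 =
    real (λ k → partial a (seq z k) k) (diagonal-cauchy t z ∣z∣<1) , λ ε 0<ε →
    let r , 0<r , r<1 , N , hN = radius z ∣z∣<1
        M₀ , hM = tail t r 0<r r<1 (½ * ε) (0<½* 0<ε)
    in M₀ , λ M M₀≤M → ½ * ε , 0<½* 0<ε , N ℕ.⊔ M , λ k hk →
      let x = seq z k
          N≤k = ℕ.≤-trans (ℕ.m≤m⊔n N M) hk
          M≤k = ℕ.≤-trans (ℕ.m≤n⊔m N M) hk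
          near : ∣ partial a x k - partial a x M ∣ ≤ ½ * ε
          near = subst (λ i → ∣ partial a x i - partial a x M ∣ ≤ ½ * ε) (ℕ.m∸n+n≡m M≤k)
            (hM M (k ℕ.∸ M) M₀≤M x (hN k N≤k))
      in subst₂ _≤_
           (cong (_+ ½ * ε) (trans (∣-∣-swap (partial a x k) (partial a x M))
             (cong (λ t → ∣ t - partial a x k ∣) (sym (seq-partial a z M k)))))
           (halves ε)
           (+-monoˡ-≤ (½ * ε) near)

open Convergence

abstract
  Li-converges : ∀ s w z → ∣ z ∣ᴿ <ᴿ 1ᴿ → ∃ (HasSum (powerSeries (summand s w) z))
  Li-converges s w = powerSeries-sum {summand s w} (tame-summand s w)

L⁻ : (z : ℝ) → ∣ z ∣ᴿ <ᴿ 1ᴿ → Series ℝ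
L⁻ z ∣z∣<1 []      = 1ᴿ
L⁻ z ∣z∣<1 (s ∷ w) = proj₁ (Li-converges s w z ∣z∣<1)

infixl 7 _⊙_ _⊙ᴿ_
_⊙_ : Series ℚ → Series ℚ → Series ℚ
(S ⊙ T) w = S w * T w

_⊙ᴿ_ : Series ℝ → Series ℝ → Series ℝ
(S ⊙ᴿ T) w = S w *ᴿ T w

_^⊙-1 : (S : Series ℚ) → (∀ w → S w ≢ 0ℚ) → Series ℚ
(S ^⊙-1) S≢0 w = (1/ S w) {{≢-nonZero (S≢0 w)}}

_^⊙ᴿ-1 : (S : Series ℝ) → (∀ w → S w #0) → Series ℝ
(S ^⊙ᴿ-1) S#0 w = inverse (S w) (S#0 w)

g : ℚ → Series ℚ
g t w = t ^ degree w

h : ℝ → Series ℝ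
h t w = fromℚ (fromℕ (degree w !)) *ᴿ t ^ᴿ degree w

g≢0 : ∀ N .{{_ : ℕ.NonZero N}} w → g (fromℕ N) w ≢ 0ℚ
g≢0 N w g≡0 = <-irrefl (sym g≡0) (0<^ (degree w) (0<fromℕ N))

h#0 : ∀ t → t #0 → ∀ w → h t w #0
h#0 t t#0 w = *-#0 (fromℚ (fromℕ (degree w !))) (t ^ᴿ degree w)
  (fromℚ-#0 _ (0<fromℕ (degree w !) {{ℕ._!≢0 (degree w)}})) (^-#0 t (degree w) t#0)

normalisedH : (N : ℕ) .{{_ : ℕ.NonZero N}} → Series ℚ
normalisedH N = (g (fromℕ N) ^⊙-1) (g≢0 N) ⊙ H⁻ N

normalisedL : (z : ℝ) → ∣ z ∣ᴿ <ᴿ 1ᴿ → Series ℝ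
normalisedL z ∣z∣<1 = (h t ^⊙ᴿ-1) (h#0 t (inverse-#0 (1ᴿ -ᴿ z) 1-z≢0)) ⊙ᴿ L⁻ z ∣z∣<1
  where
  1-z≢0 = 1-z#0 z ∣z∣<1
  t = inverse (1ᴿ -ᴿ z) 1-z≢0

C⁻ : Series ℚ
C⁻ w = productℚ (map (λ (_ , v) → factor v) (factorizations w))
  where
  -- The factorization w = w · 1 is left out of the product.
  factor : Word → ℚ
  factor []      = 1ℚ
  factor (s ∷ v) = + 1 / degree (s ∷ v)

infix 4 _⟶∞_ _⟶1⁻_
_⟶∞_ : ((N : ℕ) .{{_ : ℕ.NonZero N}} → Series ℚ) → Series ℚ → Set
F ⟶∞ S = ∀ w ε → 0ℚ < ε →
  ∃ λ N₀ → ∀ N .{{_ : ℕ.NonZero N}} → N₀ ℕ.≤ N → ∣ F N w - S w ∣ < ε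

_⟶1⁻_ : ((z : ℝ) → ∣ z ∣ᴿ <ᴿ 1ᴿ → Series ℝ) → Series ℝ → Set
F ⟶1⁻ S = ∀ w ε → 0ℚ < ε →
  ∃ λ δ → 0ℚ < δ × (∀ z (∣z∣<1 : ∣ z ∣ᴿ <ᴿ 1ᴿ) → fromℚ (1ℚ - δ) <ᴿ z →
    ∣ F z ∣z∣<1 w -ᴿ S w ∣ᴿ <ᴿ fromℚ ε)

{-# OPTIONS --safe #-}
-- H⁻(N) is the product of the factors 1 + ∑ₛ nˢ yₛ for n = N, …, 1, and left multiplication
-- by such a factor preserves group-like series.  Hence all powers H⁻(N)ᵗ are group-like.
-- Their coefficients are polynomials in t whose linear terms are the coefficients of
-- log H⁻(N), because the t-difference of H⁻(N)ᵗ is (H⁻(N) - 1) H⁻(N)ᵗ; comparing linear terms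
-- in t on both sides of the group-like identity shows that the logarithm is primitive.
--
-- The function N ↦ H⁻_w(N) has a constant difference of order d = (w) + |w|, equal to d! C⁻_w.
-- So it is a polynomial with leading term C⁻_w Nᵈ, which gives the first limit.  By
-- (1 - z) ∑ₙ f(n) zⁿ = f(0) + z ∑ₙ (f(n + 1) - f(n)) zⁿ, each factor 1 - z takes one difference
-- of the coefficients of Li⁻_w, up to terms vanishing at z = 1, which gives the second one.
-- The kernel is prime because p ↦ H⁻_p is multiplicative and polynomials form a domain.
module Submission where

open import Defs
open import Data.Nat.Base as ℕ using (ℕ; zero; suc; pred; _!)
import Data.Nat.Properties as ℕ
import Data.Integer.Base as ℤ
import Data.Integer.Properties as ℤ
open import Data.List.Base using ([]; _∷_; length; map; concatMap; filter)
open import Data.List.Properties using (map-∘; ≡-dec; length-filter; filter-reject)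
open import Data.Product.Base using (∃; _×_; _,_; proj₁; proj₂)
open import Data.Sum.Base as Sum using (_⊎_; inj₁; inj₂)
open import Data.Rational.Base using
  (ℚ; toℚᵘ; _+_; _-_; _*_; -_; _/_; 1/_; ∣_∣; _≤_; _<_; 0ℚ; 1ℚ; ½; +-*-rawSemiring;
   positive; nonNegative; ≢-nonZero)
open import Data.Rational.Properties
import Data.Rational.Unnormalised.Base as ℚᵘ
import Data.Rational.Unnormalised.Properties as ℚᵘ
open import Algebra.Definitions.RawSemiring +-*-rawSemiring using (_^_)
open import Relation.Binary.PropositionalEquality
  using (_≡_; _≢_; refl; sym; trans; cong; cong₂; subst; subst₂; module ≡-Reasoning)
open import Relation.Nullary using (¬?; yes; no; contradiction)

open S using (_:=_; _:+_; _:*_; _:-_; :-_; con)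
open ℚ-Order
open ℝ-Closure
open Inverse
open Convergence

private variable
  d e : ℕ
  f f₁ f₂ : ℕ → ℚ
  a b c a₁ a₂ b₁ b₂ c₁ c₂ : ℚ
  R T U : Series ℚ

1^ : ∀ n → 1ℚ ^ n ≡ 1ℚ
1^ zero    = refl
1^ (suc n) = trans (*-identityˡ (1ℚ ^ n)) (1^ n)

-- Functions with a constant difference of some order

-- Amounts to `f` being polynomial of degree at most `d` with coefficient `c` / d! at n^d, where `c`
-- may be 0. The first difference is carried along with a pointwise equation, so no function
-- extensionality is involved.
data Difference : ℕ → (ℕ → ℚ) → ℚ → Set where
  constant : ∀ {f c} → (∀ n → f n ≡ c) → Difference 0 f c
  step     : ∀ {d f f′ c} → (∀ n → f (suc n) ≡ f n + f′ n) → Difference d f′ c → Difference (suc d) f c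

difference-shift : Difference d f c → Difference d (λ n → f (suc n)) c
difference-shift (constant eq) = constant λ n → eq (suc n)
difference-shift (step {f = f} {f′} eq D) = step {f = λ n → f (suc n)} {f′ = λ n → f′ (suc n)} (λ n → eq (suc n)) (difference-shift D)

difference-+ : Difference d f₁ c₁ → Difference d f₂ c₂ →
               Difference d (λ n → f₁ n + f₂ n) (c₁ + c₂)
difference-+ (constant eq₁) (constant eq₂) = constant λ n → cong₂ _+_ (eq₁ n) (eq₂ n)
difference-+ (step {f = f₁} {f₁′} eq₁ D₁) (step {f = f₂} {f₂′} eq₂ D₂) = step
  {f = λ n → f₁ n + f₂ n} {f′ = λ n → f₁′ n + f₂′ n}
  (λ n → trans (cong₂ _+_ (eq₁ n) (eq₂ n))
    (S.solve 4 (λ a b c d → (a :+ b) :+ (c :+ d) := (a :+ c) :+ (b :+ d)) refl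
      (f₁ n) (f₁′ n) (f₂ n) (f₂′ n)))
  (difference-+ D₁ D₂)

difference-scale : ∀ k → Difference d f c → Difference d (λ n → k * f n) (k * c)
difference-scale k (constant eq) = constant λ n → cong (k *_) (eq n)
difference-scale k (step {f = f} {f′} eq D) = step
  {f = λ n → k * f n} {f′ = λ n → k * f′ n}
  (λ n → trans (cong (k *_) (eq n)) (*-distribˡ-+ k (f n) (f′ n))) (difference-scale k D)

-- A discrete Leibniz rule: as `ℓ` has slope 1, the difference of ℓ f at n is ℓ(n) f′(n) + f(n + 1).
-- The first term contributes d c by induction and the shifted `f` contributes one more c.
difference-linear : ∀ (ℓ : ℕ → ℚ) → (∀ n → ℓ (suc n) ≡ 1ℚ + ℓ n) → Difference d f c →
                    Difference (suc d) (λ n → ℓ n * f n) (fromℕ (suc d) * c)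
difference-linear {f = f} {c} ℓ ℓ-suc (constant eq) = step {f = λ n → ℓ n * f n} {f′ = λ _ → c}
  (λ n → trans (cong₂ _*_ (ℓ-suc n) (trans (eq (suc n)) (sym (eq n))))
    (trans (S.solve 2 (λ a b → (con 1ℚ :+ a) :* b := a :* b :+ b) refl (ℓ n) (f n))
      (cong ((ℓ n * f n) +_) (eq n))))
  (constant λ _ → sym (*-identityˡ c))
difference-linear {suc d} {f} {c} ℓ ℓ-suc (step {f′ = f′} eq D) = step
  {f = λ n → ℓ n * f n} {f′ = λ n → ℓ n * f′ n + f (suc n)}
  (λ n → trans (cong₂ _*_ (ℓ-suc n) (eq n))
    (trans (S.solve 3 (λ a b c → (con 1ℚ :+ a) :* (b :+ c) := a :* b :+ (a :* c :+ (b :+ c)))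
        refl (ℓ n) (f n) (f′ n))
      (cong (λ t → ℓ n * f n + (ℓ n * f′ n + t)) (sym (eq n)))))
  (subst (Difference (suc d) _)
    (trans (S.solve 2 (λ m c → m :* c :+ c := (con 1ℚ :+ m) :* c) refl (fromℕ (suc d)) c)
      (cong (_* c) (sym (fromℕ-suc (suc d)))))
    (difference-+ (difference-linear ℓ ℓ-suc D) (difference-shift (step {f = f} eq D))))

difference-cong : (∀ n → f₁ n ≡ f₂ n) → Difference d f₁ c → Difference d f₂ c
difference-cong h (constant eq) = constant λ n → trans (sym (h n)) (eq n)
difference-cong {f₂ = f₂} h (step {f′ = f′} eq D) = step {f = f₂} {f′}
  (λ n → trans (sym (h (suc n))) (trans (eq n) (cong (_+ f′ n) (h n)))) D

-- Each factor `ℓ` raises the order by one and multiplies the constant by the new order. Written as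
-- a factorial times `c`, the leading coefficient `c` stays the same.
difference-power : ∀ (ℓ : ℕ → ℚ) → (∀ n → ℓ (suc n) ≡ 1ℚ + ℓ n) → ∀ s →
                   Difference d f (fromℕ (d !) * c) →
                   Difference (s ℕ.+ d) (λ n → ℓ n ^ s * f n) (fromℕ ((s ℕ.+ d) !) * c)
difference-power {f = f} ℓ ℓ-suc zero    D = difference-cong (λ n → sym (*-identityˡ (f n))) D
difference-power {d} {f} {c} ℓ ℓ-suc (suc s) D =
  difference-cong (λ n → sym (*-assoc (ℓ n) (ℓ n ^ s) (f n)))
    (subst (Difference _ _)
      (trans (sym (*-assoc (fromℕ (suc (s ℕ.+ d))) _ c))
        (cong (_* c) (sym (fromℕ-* (suc (s ℕ.+ d)) ((s ℕ.+ d) !)))))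
      (difference-linear ℓ ℓ-suc (difference-power ℓ ℓ-suc s D)))

-- If the top difference vanishes, then the one before it is constant. This makes cancelling the
-- leading terms lower the order.
difference-lower : Difference (suc d) f 0ℚ → ∃ (Difference d f)
difference-lower {f = f} (step eq (constant eq₀)) = f 0 , constant go
  where
  go : ∀ n → f n ≡ f 0
  go zero    = refl
  go (suc n) = trans (eq n) (trans (cong₂ _+_ (go n) (eq₀ n)) (+-identityʳ (f 0)))
difference-lower {f = f} (step {f′ = f′} eq D@(step _ _)) = let c , D′ = difference-lower D in c , step {f = f} {f′} eq D′

-- Harmonic sums have a constant difference

fromℕ-^ : ∀ n s → fromℕ (n ℕ.^ s) ≡ fromℕ n ^ s
fromℕ-^ n zero    = refl
fromℕ-^ n (suc s) = trans (fromℕ-* n (n ℕ.^ s)) (cong (fromℕ n *_) (fromℕ-^ n s))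

C⁻-∷ : ∀ s w → C⁻ (s ∷ w) ≡ (ℤ.+ 1 / degree (s ∷ w)) * C⁻ w
C⁻-∷ s w = cong (λ l → (ℤ.+ 1 / degree (s ∷ w)) * productℚ l) (sym (map-∘ (factorizations w)))

fromℕ-1/ : ∀ n .{{_ : ℕ.NonZero n}} → fromℕ n * (ℤ.+ 1 / n) ≡ 1ℚ
fromℕ-1/ n@(suc m) = toℚᵘ-injective (begin
  toℚᵘ (fromℕ n * (ℤ.+ 1 / n))                ≈⟨ toℚᵘ-homo-* (fromℕ n) (ℤ.+ 1 / n) ⟩
  toℚᵘ (fromℕ n) ℚᵘ.* toℚᵘ (ℤ.+ 1 / n)        ≈⟨ ℚᵘ.*-cong (toℚᵘ-fromℕ n) (toℚᵘ-fromℚᵘ (ℚᵘ.mkℚᵘ (ℤ.+ 1) m)) ⟩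
  ℚᵘ.mkℚᵘ (ℤ.+ n) 0 ℚᵘ.* ℚᵘ.mkℚᵘ (ℤ.+ 1) m      ≈⟨ ℚᵘ.*≡* (trans (ℤ.*-identityʳ _)
       (trans (ℤ.*-identityʳ (ℤ.+ n)) (trans (cong ℤ.+_ (sym (ℕ.*-identityˡ n))) (sym (ℤ.*-identityˡ _))))) ⟩
  ℚᵘ.mkℚᵘ (ℤ.+ 1) 0                           ∎)
  where open ℚᵘ.≃-Reasoning

-- Induction along the nested sums: the difference of a sum is its next summand, and the factor (n +
-- 1)^s raises the order by s. Summation raises the order without changing the constant, so m! must
-- be rewritten as (m + 1)! / (m + 1); these denominators are the factors of `C⁻`.
H-difference : ∀ w → Difference (degree w) (λ N → H⁻ N w) (fromℕ (degree w !) * C⁻ w)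
summand-difference : ∀ s w → Difference (length w ℕ.+ (s ℕ.+ weight w))
  (λ n → fromℕ (summand s w (suc n))) (fromℕ (degree (s ∷ w) !) * C⁻ (s ∷ w))
H-difference []      = constant λ _ → refl
H-difference (s ∷ w) = step (λ N → fromℕ-+ (H (s ∷ w) N) (summand s w (suc N))) (summand-difference s w)
summand-difference s w = subst₂ (λ d c → Difference d (λ n → fromℕ (summand s w (suc n))) c)
  degree-eq leading
  (difference-cong
    (λ n → trans (cong (_* H⁻ n w) (sym (fromℕ-^ (suc n) s)))
      (sym (fromℕ-* (suc n ℕ.^ s) (H w n))))
    (difference-power (λ n → fromℕ (suc n)) (λ n → fromℕ-suc (suc n)) s (H-difference w)))
  where
  degree-eq : s ℕ.+ degree w ≡ length w ℕ.+ (s ℕ.+ weight w)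
  degree-eq = trans (sym (ℕ.+-assoc s (length w) (weight w)))
    (trans (cong (ℕ._+ weight w) (ℕ.+-comm s (length w))) (ℕ.+-assoc (length w) s (weight w)))
  m = length w ℕ.+ (s ℕ.+ weight w)
  leading : fromℕ ((s ℕ.+ degree w) !) * C⁻ w ≡ fromℕ (degree (s ∷ w) !) * C⁻ (s ∷ w)
  leading = begin
    fromℕ ((s ℕ.+ degree w) !) * C⁻ w
      ≡⟨ cong (λ k → fromℕ (k !) * C⁻ w) degree-eq ⟩
    fromℕ (m !) * C⁻ w
      ≡⟨ sym (*-identityˡ _) ⟩
    1ℚ * (fromℕ (m !) * C⁻ w)
      ≡⟨ cong (_* (fromℕ (m !) * C⁻ w)) (sym (fromℕ-1/ (suc m))) ⟩
    fromℕ (suc m) * (ℤ.+ 1 / suc m) * (fromℕ (m !) * C⁻ w)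
      ≡⟨ S.solve 4 (λ n i f c → n :* i :* (f :* c) := n :* f :* (i :* c)) refl
           (fromℕ (suc m)) (ℤ.+ 1 / suc m) (fromℕ (m !)) (C⁻ w) ⟩
    fromℕ (suc m) * fromℕ (m !) * ((ℤ.+ 1 / suc m) * C⁻ w)
      ≡⟨ cong₂ _*_ (sym (fromℕ-* (suc m) (m !))) (sym (C⁻-∷ s w)) ⟩
    fromℕ (degree (s ∷ w) !) * C⁻ (s ∷ w) ∎
    where open ≡-Reasoning

-- Growth of functions with a constant difference

^-mono : ∀ {x y} n → 0ℚ ≤ x → x ≤ y → x ^ n ≤ y ^ n
^-mono zero    0≤x x≤y = ≤-refl
^-mono (suc n) 0≤x x≤y = *-mono 0≤x x≤y (0≤^ n 0≤x) (^-mono n 0≤x x≤y)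
  where
  0≤^ : ∀ {x} n → 0ℚ ≤ x → 0ℚ ≤ x ^ n
  0≤^ zero    0≤x = <⇒≤ 0<1
  0≤^ (suc n) 0≤x = 0≤* 0≤x (0≤^ n 0≤x)

-- Telescoping: each of the n increments up to n is at most K (n + 1)^d.
growth-sum : ∀ d K → 0ℚ ≤ K → (∀ n → f₁ (suc n) ≡ f₁ n + f₂ n) →
             (∀ n → ∣ f₂ n ∣ ≤ K * fromℕ (suc n) ^ d) →
             ∀ n → ∣ f₁ n ∣ ≤ (∣ f₁ 0 ∣ + fromℕ n * K) * fromℕ (suc n) ^ d
growth-sum {f₁} d K 0≤K eq hK zero = ≤-reflexive
  (sym (trans (cong₂ (λ s t → (∣ f₁ 0 ∣ + s) * t) (*-zeroˡ K) (1^ d))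
    (trans (*-identityʳ (∣ f₁ 0 ∣ + 0ℚ)) (+-identityʳ (∣ f₁ 0 ∣)))))
growth-sum {f₁} {f₂} d K 0≤K eq hK (suc n) = ≤-trans
  (subst (_≤ ∣ f₁ n ∣ + ∣ f₂ n ∣) (cong ∣_∣ (sym (eq n))) (∣p+q∣≤∣p∣+∣q∣ (f₁ n) (f₂ n)))
  (≤-trans (+-mono-≤ (growth-sum {f₁} {f₂} d K 0≤K eq hK n) (hK n))
  (≤-trans (≤-reflexive (trans
    (S.solve 4 (λ a n k p → (a :+ n :* k) :* p :+ k :* p := (a :+ (con 1ℚ :+ n) :* k) :* p)
      refl (∣ f₁ 0 ∣) (fromℕ n) K (fromℕ (suc n) ^ d))
    (cong (λ t → (∣ f₁ 0 ∣ + t * K) * fromℕ (suc n) ^ d) (sym (fromℕ-suc n)))))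
  (*-mono (0≤+ (0≤∣p∣ (f₁ 0)) (0≤* (0≤fromℕ (suc n)) 0≤K)) ≤-refl
    (<⇒≤ (0<^ d (0<fromℕ (suc n))))
    (^-mono d (0≤fromℕ (suc n)) (fromℕ-mono (ℕ.n≤1+n (suc n)))))))

-- Induction on the order, where A + n K ≤ (A + K) (n + 1) absorbs the number of increments into one
-- more power. The base n + 1 keeps the bound meaningful at n = 0.
difference-growth : Difference d f c → ∃ λ K → 0ℚ ≤ K × ∀ n → ∣ f n ∣ ≤ K * fromℕ (suc n) ^ d
difference-growth {c = c} (constant eq) = ∣ c ∣ , 0≤∣p∣ c , λ n →
  ≤-reflexive (trans (cong ∣_∣ (eq n)) (sym (*-identityʳ (∣ c ∣))))
difference-growth {suc d} {f} (step {f′ = f′} eq D) =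
  let K , 0≤K , hK = difference-growth D
      A = ∣ f 0 ∣
  in A + K , 0≤+ (0≤∣p∣ (f 0)) 0≤K , λ n → ≤-trans (growth-sum {f} {f′} d K 0≤K eq hK n) (≤-trans
      (*-monoʳ-≤-nonNeg (fromℕ (suc n) ^ d) {{nonNegative (<⇒≤ (0<^ d (0<fromℕ (suc n))))}}
        (diff-≤ {A + fromℕ n * K} {(A + K) * fromℕ (suc n)} (subst (0ℚ ≤_)
          (trans (S.solve 3 (λ a n k → n :* a :+ k := (a :+ k) :* (con 1ℚ :+ n) :- (a :+ n :* k))
              refl A (fromℕ n) K)
            (cong (λ t → (A + K) * t - (A + fromℕ n * K)) (sym (fromℕ-suc n))))
          (0≤+ (0≤* (0≤fromℕ n) (0≤∣p∣ (f 0))) 0≤K))))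
      (≤-reflexive (*-assoc (A + K) (fromℕ (suc n)) (fromℕ (suc n) ^ d))))

-- Polynomial functions and their expansions at 0

*-zero-split : ∀ p q → p * q ≡ 0ℚ → p ≡ 0ℚ ⊎ q ≡ 0ℚ
*-zero-split p q eq with p ≟ 0ℚ
... | yes p≡0 = inj₁ p≡0
... | no  p≢0 = inj₂ (cancel-nonzero p q p≢0 eq)
  where
  cancel-nonzero : ∀ p q → p ≢ 0ℚ → p * q ≡ 0ℚ → q ≡ 0ℚ
  cancel-nonzero p q p≢0 eq = let instance _ = ≢-nonZero p≢0 in
    trans (sym (*-identityˡ q)) (trans (cong (_* q) (sym (*-inverseˡ p)))
      (trans (*-assoc (1/ p) p q) (trans (cong (1/ p *_) eq) (*-zeroʳ (1/ p)))))

-- The index counts coefficients, so it strictly bounds the degree, and only the zero function has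
-- index 0.
data Horner : ℕ → (ℕ → ℚ) → Set where
  nil  : ∀ {f} → (∀ n → f n ≡ 0ℚ) → Horner 0 f
  cons : ∀ {d f} a f₁ → (∀ n → f n ≡ a + fromℕ n * f₁ n) → Horner d f₁ → Horner (suc d) f

-- Synthetic division by n - k: the Horner scheme evaluated at `k` produces the coefficients of the
-- quotient, one fewer than those of `f`.
horner-divide : ∀ k → Horner (suc d) f →
  ∃ λ q → Horner d q × ∀ n → f n ≡ f k + (fromℕ n - fromℕ k) * q n
horner-divide {f = f} k (cons a f₁ eq (nil eq₀)) = (λ _ → 0ℚ) , nil (λ _ → refl) , λ n →
  trans (trans (eq n) (cong (λ t → a + fromℕ n * t) (eq₀ n)))
    (trans (S.solve 3 (λ a n k → a :+ n :* con 0ℚ := (a :+ k :* con 0ℚ) :+ (n :- k) :* con 0ℚ)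
        refl a (fromℕ n) (fromℕ k))
      (cong (_+ (fromℕ n - fromℕ k) * 0ℚ)
        (sym (trans (eq k) (cong (λ t → a + fromℕ k * t) (eq₀ k))))))
horner-divide {f = f} k (cons a f₁ eq P@(cons _ _ _ _)) =
  let q , Q , eq′ = horner-divide k P in
  (λ n → f₁ k + fromℕ n * q n) , cons (f₁ k) q (λ _ → refl) Q , λ n →
    trans (trans (eq n) (cong (λ t → a + fromℕ n * t) (eq′ n)))
      (trans (S.solve 5 (λ a n k c q → a :+ n :* (c :+ (n :- k) :* q) :=
            (a :+ k :* c) :+ (n :- k) :* (c :+ n :* q)) refl a (fromℕ n) (fromℕ k) (f₁ k) (q n))
        (cong (_+ (fromℕ n - fromℕ k) * (f₁ k + fromℕ n * q n)) (sym (eq k))))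

fromℕ-≢ : ∀ {k n} → k ℕ.< n → fromℕ n - fromℕ k ≢ 0ℚ
fromℕ-≢ {k} {n} k<n eq = <-irrefl (sym eq) (<-≤-trans 0<1
  (diff-≤ {1ℚ} {fromℕ n - fromℕ k} (subst (0ℚ ≤_)
    (trans (cong (λ t → fromℕ n - t) (fromℕ-suc k))
      (S.solve 2 (λ n k → n :- (con 1ℚ :+ k) := (n :- k) :- con 1ℚ) refl (fromℕ n) (fromℕ k)))
    (≤-diff (fromℕ-mono k<n)))))

-- A root of one factor is divided out, which lowers the total degree.
horner-domain : ∀ k → Horner d f₁ → Horner e f₂ → (∀ n → k ℕ.≤ n → f₁ n * f₂ n ≡ 0ℚ) →
                (∀ n → f₁ n ≡ 0ℚ) ⊎ (∀ n → f₂ n ≡ 0ℚ)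
horner-domain k (nil eq) Q h = inj₁ eq
horner-domain k P@(cons _ _ _ _) (nil eq) h = inj₂ eq
horner-domain {suc d} {f₁} {suc e} {f₂} k P@(cons _ _ _ _) Q@(cons _ _ _ _) h =
  split-root (*-zero-split (f₁ k) (f₂ k) (h k ℕ.≤-refl))
  where
  p = proj₁ (horner-divide k P)
  Hp = proj₁ (proj₂ (horner-divide k P))
  eqp = proj₂ (proj₂ (horner-divide k P))
  q = proj₁ (horner-divide k Q)
  Hq = proj₁ (proj₂ (horner-divide k Q))
  eqq = proj₂ (proj₂ (horner-divide k Q))
  root : ∀ {f : ℕ → ℚ} {q} → (∀ n → f n ≡ f k + (fromℕ n - fromℕ k) * q n) → f k ≡ 0ℚ →
         ∀ n → f n ≡ (fromℕ n - fromℕ k) * q n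
  root {q = q} eq fk n = trans (eq n) (trans (cong (_+ (fromℕ n - fromℕ k) * q n) fk) (+-identityˡ _))
  vanish : ∀ {f : ℕ → ℚ} {q} → (∀ n → f n ≡ (fromℕ n - fromℕ k) * q n) → (∀ n → q n ≡ 0ℚ) →
           ∀ n → f n ≡ 0ℚ
  vanish eq q≡0 n = trans (eq n) (trans (cong ((fromℕ n - fromℕ k) *_) (q≡0 n)) (*-zeroʳ (fromℕ n - fromℕ k)))
  -- Among the n ≥ k, the factor n - k can be cancelled only for n > k. Hence the recursive calls
  -- assume a vanishing product only from `suc k` on.
  cancel : ∀ n r → suc k ℕ.≤ n → (fromℕ n - fromℕ k) * r ≡ 0ℚ → r ≡ 0ℚ
  cancel n r k<n eq = Sum.[ (λ z → contradiction z (fromℕ-≢ k<n)) , (λ z → z) ]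
    (*-zero-split (fromℕ n - fromℕ k) r eq)
  split-root : f₁ k ≡ 0ℚ ⊎ f₂ k ≡ 0ℚ → (∀ n → f₁ n ≡ 0ℚ) ⊎ (∀ n → f₂ n ≡ 0ℚ)
  split-root (inj₁ z) = Sum.map₁ (vanish {f₁} {p} (root {f₁} {p} eqp z))
    (horner-domain (suc k) Hp Q (λ n k<n → cancel n (p n * f₂ n) k<n
      (trans (sym (*-assoc (fromℕ n - fromℕ k) (p n) (f₂ n)))
        (trans (cong (_* f₂ n) (sym (root {f₁} {p} eqp z n))) (h n (ℕ.<⇒≤ k<n))))))
  split-root (inj₂ z) = Sum.map₂ (vanish {f₂} {q} (root {f₂} {q} eqq z))
    (horner-domain (suc k) P Hq (λ n k<n → cancel n (f₁ n * q n) k<n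
      (trans (S.solve 3 (λ x p q → x :* (p :* q) := p :* (x :* q)) refl (fromℕ n - fromℕ k) (f₁ n) (q n))
        (trans (cong (f₁ n *_) (sym (root {f₂} {q} eqq z n))) (h n (ℕ.<⇒≤ k<n))))))

record IsPolynomial (f : ℕ → ℚ) : Set where
  constructor polynomial
  field
    {bound} : ℕ
    horner  : Horner bound f
open IsPolynomial

polynomial-cons : ∀ a f₁ → (∀ n → f n ≡ a + fromℕ n * f₁ n) → IsPolynomial f₁ → IsPolynomial f
polynomial-cons a f₁ eq (polynomial P) = polynomial (cons a f₁ eq P)

polynomial-cong : (∀ n → f₁ n ≡ f₂ n) → IsPolynomial f₁ → IsPolynomial f₂
polynomial-cong h (polynomial (nil eq))        = polynomial (nil λ n → trans (sym (h n)) (eq n))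
polynomial-cong h (polynomial (cons a q eq P)) =
  polynomial (cons a q (λ n → trans (sym (h n)) (eq n)) P)

polynomial-const : ∀ a → IsPolynomial (λ _ → a)
polynomial-const a = polynomial (cons a (λ _ → 0ℚ)
  (λ n → sym (trans (cong (a +_) (*-zeroʳ (fromℕ n))) (+-identityʳ a))) (nil λ _ → refl))

polynomial-+ : IsPolynomial f₁ → IsPolynomial f₂ → IsPolynomial (λ n → f₁ n + f₂ n)
polynomial-+ {f₂ = f₂} (polynomial (nil eq)) Q =
  polynomial-cong (λ n → sym (trans (cong (_+ f₂ n) (eq n)) (+-identityˡ (f₂ n)))) Q
polynomial-+ {f₁} P@(polynomial (cons _ _ _ _)) (polynomial (nil eq)) =
  polynomial-cong (λ n → sym (trans (cong (f₁ n +_) (eq n)) (+-identityʳ (f₁ n)))) P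
polynomial-+ (polynomial (cons a p eq P)) (polynomial (cons b q eq′ Q)) =
  polynomial-cons (a + b) (λ n → p n + q n)
  (λ n → trans (cong₂ _+_ (eq n) (eq′ n))
    (S.solve 5 (λ a b n p q → (a :+ n :* p) :+ (b :+ n :* q) := (a :+ b) :+ n :* (p :+ q)) refl
      a b (fromℕ n) (p n) (q n)))
  (polynomial-+ (polynomial P) (polynomial Q))

polynomial-scale : ∀ k → IsPolynomial f → IsPolynomial (λ n → k * f n)
polynomial-scale k (polynomial (nil eq)) =
  polynomial (nil λ n → trans (cong (k *_) (eq n)) (*-zeroʳ k))
polynomial-scale k (polynomial (cons a p eq P)) = polynomial-cons (k * a) (λ n → k * p n)
  (λ n → trans (cong (k *_) (eq n))
    (S.solve 4 (λ k a n p → k :* (a :+ n :* p) := k :* a :+ n :* (k :* p)) refl k a (fromℕ n) (p n)))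
  (polynomial-scale k (polynomial P))

polynomial-n* : IsPolynomial f → IsPolynomial (λ n → fromℕ n * f n)
polynomial-n* {f} P = polynomial-cons 0ℚ f (λ n → sym (+-identityˡ (fromℕ n * f n))) P

polynomial-* : IsPolynomial f₁ → IsPolynomial f₂ → IsPolynomial (λ n → f₁ n * f₂ n)
polynomial-* {f₂ = f₂} (polynomial (nil eq)) Q =
  polynomial (nil λ n → trans (cong (_* f₂ n) (eq n)) (*-zeroˡ (f₂ n)))
polynomial-* {f₂ = f₂} (polynomial (cons a p eq P)) Q = polynomial-cong
  (λ n → sym (trans (cong (_* f₂ n) (eq n))
    (S.solve 4 (λ a n p q → (a :+ n :* p) :* q := a :* q :+ n :* (p :* q)) refl
      a (fromℕ n) (p n) (f₂ n))))
  (polynomial-+ (polynomial-scale a Q) (polynomial-n* (polynomial-* (polynomial P) Q)))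

-- A polynomial function modulo n². Requiring a polynomial remainder is what determines `b`: an
-- arbitrary function as remainder could absorb any choice of it.
record Jet (f : ℕ → ℚ) (a b : ℚ) : Set where
  constructor jet
  field
    remainder            : ℕ → ℚ
    remainder-polynomial : IsPolynomial remainder
    expansion            : ∀ n → f n ≡ a + fromℕ n * (b + fromℕ n * remainder n)

jet-polynomial : Jet f a b → IsPolynomial f
jet-polynomial {a = a} {b} (jet q P eq) = polynomial-cons a (λ n → b + fromℕ n * q n) eq
  (polynomial-cons b q (λ _ → refl) P)

jet-cong : (∀ n → f₁ n ≡ f₂ n) → Jet f₁ a b → Jet f₂ a b
jet-cong h (jet q P eq) = jet q P λ n → trans (sym (h n)) (eq n)

jet-linear : ∀ a b → Jet (λ n → a + fromℕ n * b) a b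
jet-linear a b = jet (λ _ → 0ℚ) (polynomial-const 0ℚ) λ n → cong (λ t → a + fromℕ n * t)
  (sym (trans (cong (b +_) (*-zeroʳ (fromℕ n))) (+-identityʳ b)))

jet-const : ∀ a → Jet (λ _ → a) a 0ℚ
jet-const a = jet-cong (λ n → trans (cong (a +_) (*-zeroʳ (fromℕ n))) (+-identityʳ a)) (jet-linear a 0ℚ)

jet-+ : Jet f₁ a₁ b₁ → Jet f₂ a₂ b₂ → Jet (λ n → f₁ n + f₂ n) (a₁ + a₂) (b₁ + b₂)
jet-+ {a₁ = a₁} {b₁} {a₂ = a₂} {b₂} (jet p P eq) (jet q Q eq′) = jet (λ n → p n + q n) (polynomial-+ P Q)
  λ n → trans (cong₂ _+_ (eq n) (eq′ n))
    (S.solve 7 (λ a b c d n p q → (a :+ n :* (b :+ n :* p)) :+ (c :+ n :* (d :+ n :* q)) :=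
      (a :+ c) :+ n :* ((b :+ d) :+ n :* (p :+ q))) refl a₁ b₁ a₂ b₂ (fromℕ n) (p n) (q n))

jet-* : Jet f₁ a₁ b₁ → Jet f₂ a₂ b₂ → Jet (λ n → f₁ n * f₂ n) (a₁ * a₂) (b₁ * a₂ + a₁ * b₂)
jet-* {a₁ = a₁} {b₁} {a₂ = a₂} {b₂} (jet p P eq) (jet q Q eq′) = jet
  (λ n → (a₁ * q n + a₂ * p n) + (b₁ * (b₂ + fromℕ n * q n) + p n * (fromℕ n * (b₂ + fromℕ n * q n))))
  (polynomial-+ (polynomial-+ (polynomial-scale a₁ Q) (polynomial-scale a₂ P))
    (polynomial-+ (polynomial-scale b₁ Q′) (polynomial-* P (polynomial-n* Q′))))
  λ n → trans (cong₂ _*_ (eq n) (eq′ n))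
    (S.solve 7 (λ a b c d n p q → (a :+ n :* (b :+ n :* p)) :* (c :+ n :* (d :+ n :* q)) :=
      a :* c :+ n :* ((b :* c :+ a :* d) :+ n :* ((a :* q :+ c :* p) :+
        (b :* (d :+ n :* q) :+ p :* (n :* (d :+ n :* q)))))) refl a₁ b₁ a₂ b₂ (fromℕ n) (p n) (q n))
  where
  Q′ : IsPolynomial (λ n → b₂ + fromℕ n * q n)
  Q′ = polynomial-cons b₂ q (λ _ → refl) Q

-- The two expansions differ by n r(n) with `r` polynomial. At n = 0 this product says nothing about
-- `r`, but polynomials form a domain, so `r` vanishes there too, and r(0) = b₁ - b₂.
jet-unique : Jet f a₁ b₁ → Jet f a₂ b₂ → b₁ ≡ b₂
jet-unique {f} {a₁} {b₁} {a₂} {b₂} (jet p P eq) (jet q Q eq′) = difference-zero b₁ b₂ b₁-b₂≡0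
  where
  difference-zero : ∀ x y → x - y ≡ 0ℚ → x ≡ y
  difference-zero x y eq = trans (S.solve 2 (λ x y → x := (x :- y) :+ y) refl x y)
    (trans (cong (_+ y) eq) (+-identityˡ y))
  at-0 : ∀ a c → a + fromℕ 0 * c ≡ a
  at-0 a c = trans (cong (a +_) (*-zeroˡ c)) (+-identityʳ a)
  a₁≡a₂ : a₁ ≡ a₂
  a₁≡a₂ = trans (sym (trans (eq 0) (at-0 a₁ (b₁ + fromℕ 0 * p 0)))) (trans (eq′ 0) (at-0 a₂ (b₂ + fromℕ 0 * q 0)))
  r : ℕ → ℚ
  r n = (b₁ - b₂) + fromℕ n * (p n + - 1ℚ * q n)
  nr : ∀ n → fromℕ n * r n ≡ 0ℚ
  nr n = begin
    fromℕ n * r n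
      ≡⟨ S.solve 6 (λ a b d n p q → n :* ((b :- d) :+ n :* (p :+ :- con 1ℚ :* q)) :=
           (a :+ n :* (b :+ n :* p)) :- (a :+ n :* (d :+ n :* q))) refl a₁ b₁ b₂ (fromℕ n) (p n) (q n) ⟩
    (a₁ + fromℕ n * (b₁ + fromℕ n * p n)) - (a₁ + fromℕ n * (b₂ + fromℕ n * q n))
      ≡⟨ cong₂ _-_ (sym (eq n)) (trans (cong (_+ fromℕ n * (b₂ + fromℕ n * q n)) a₁≡a₂) (sym (eq′ n))) ⟩
    f n - f n ≡⟨ +-inverseʳ (f n) ⟩
    0ℚ ∎
    where open ≡-Reasoning
  r-polynomial : IsPolynomial r
  r-polynomial = polynomial-cons (b₁ - b₂) (λ n → p n + - 1ℚ * q n) (λ _ → refl) (polynomial-+ P (polynomial-scale (- 1ℚ) Q))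
  n-polynomial : IsPolynomial fromℕ
  n-polynomial = polynomial-cong (λ n → *-identityʳ (fromℕ n)) (polynomial-n* (polynomial-const 1ℚ))
  b₁-b₂≡0 : b₁ - b₂ ≡ 0ℚ
  b₁-b₂≡0 = Sum.[ (λ z → contradiction (z 1) λ ()) ,
                  (λ z → trans (sym (at-0 (b₁ - b₂) (p 0 + - 1ℚ * q 0))) (z 0)) ]
    (horner-domain 0 (horner n-polynomial) (horner r-polynomial) (λ n _ → nr n))

-- Binomial polynomials and Newton's forward difference formula

binomial : ℕ → ℕ → ℚ
binomial zero    t = 1ℚ
binomial (suc n) t = binomial n t * ((fromℕ t - fromℕ n) * (ℤ.+ 1 / suc n))

binomial-0 : ∀ n → binomial (suc n) 0 ≡ 0ℚ
binomial-0 zero    = refl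
binomial-0 (suc n) = trans (cong (_* ((0ℚ - fromℕ (suc n)) * (ℤ.+ 1 / suc (suc n)))) (binomial-0 n))
  (*-zeroˡ ((0ℚ - fromℕ (suc n)) * (ℤ.+ 1 / suc (suc n))))

pascal : ∀ n t → binomial (suc n) (suc t) ≡ binomial (suc n) t + binomial n t
pascal zero    t = trans (cong (λ m → 1ℚ * ((m - 0ℚ) * 1ℚ)) (fromℕ-suc t))
  (S.solve 1 (λ t → con 1ℚ :* (((con 1ℚ :+ t) :- con 0ℚ) :* con 1ℚ) :=
    con 1ℚ :* ((t :- con 0ℚ) :* con 1ℚ) :+ con 1ℚ) refl (fromℕ t))
pascal (suc n) t = begin
  binomial (suc n) (suc t) * ((fromℕ (suc t) - fromℕ (suc n)) * v)
    ≡⟨ cong₂ (λ b m → b * ((m - fromℕ (suc n)) * v)) (pascal n t) (fromℕ-suc t) ⟩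
  (B * ((x - fromℕ n) * u) + B) * (((1ℚ + x) - fromℕ (suc n)) * v)
    ≡⟨ cong (λ m → (B * ((x - fromℕ n) * u) + B) * (((1ℚ + x) - m) * v)) (fromℕ-suc n) ⟩
  (B * ((x - y) * u) + B) * (((1ℚ + x) - (1ℚ + y)) * v)
    ≡⟨ S.solve 5 (λ B x y u v →
         (B :* ((x :- y) :* u) :+ B) :* (((con 1ℚ :+ x) :- (con 1ℚ :+ y)) :* v) :=
         (B :* ((x :- y) :* u)) :* ((x :- (con 1ℚ :+ y)) :* v) :+ B :* (x :- y) :* (v :+ u :* v))
         refl B x y u v ⟩
  B * ((x - y) * u) * ((x - (1ℚ + y)) * v) + B * (x - y) * (v + u * v)
    ≡⟨ cong₂ (λ m k → B * ((x - y) * u) * ((x - m) * v) + B * (x - y) * k) (sym (fromℕ-suc n)) uv ⟩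
  binomial (suc (suc n)) t + B * (x - y) * u
    ≡⟨ cong (λ k → binomial (suc (suc n)) t + k) (*-assoc B (x - y) u) ⟩
  binomial (suc (suc n)) t + binomial (suc n) t ∎
  where
  open ≡-Reasoning
  B = binomial n t
  x = fromℕ t
  y = fromℕ n
  u = ℤ.+ 1 / suc n
  v = ℤ.+ 1 / suc (suc n)
  uv : v + u * v ≡ u
  uv = begin
    v + u * v                           ≡⟨ cong (_+ u * v) (sym (*-identityʳ v)) ⟩
    v * 1ℚ + u * v                      ≡⟨ cong (λ k → v * k + u * v) (sym (fromℕ-1/ (suc n))) ⟩
    v * (fromℕ (suc n) * u) + u * v     ≡⟨ S.solve 3 (λ v m u → v :* (m :* u) :+ u :* v :=
                                             ((con 1ℚ :+ m) :* v) :* u) refl v (fromℕ (suc n)) u ⟩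
    (1ℚ + fromℕ (suc n)) * v * u        ≡⟨ cong (λ k → k * v * u) (sym (fromℕ-suc (suc n))) ⟩
    fromℕ (suc (suc n)) * v * u         ≡⟨ cong (_* u) (fromℕ-1/ (suc (suc n))) ⟩
    1ℚ * u                              ≡⟨ *-identityˡ u ⟩
    u                                   ∎

-- The linear coefficients of the binomials are those of log (1 + X).
binomial-jet : ∀ n → Jet (binomial (suc n)) 0ℚ ((- 1ℚ) ^ n * (ℤ.+ 1 / suc n))
binomial-jet n = jet-cong (λ t → cong (binomial n t *_) (linear t)) (jet-at n)
  where
  linear : ∀ t → - fromℕ n * (ℤ.+ 1 / suc n) + fromℕ t * (ℤ.+ 1 / suc n) ≡ (fromℕ t - fromℕ n) * (ℤ.+ 1 / suc n)
  linear t = S.solve 3 (λ n t u → :- n :* u :+ t :* u := (t :- n) :* u) refl (fromℕ n) (fromℕ t) (ℤ.+ 1 / suc n)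
  jet-at : ∀ n → Jet (λ t → binomial n t * (- fromℕ n * (ℤ.+ 1 / suc n) + fromℕ t * (ℤ.+ 1 / suc n)))
                     0ℚ ((- 1ℚ) ^ n * (ℤ.+ 1 / suc n))
  jet-at zero    = jet-* (jet-const 1ℚ) (jet-linear (- 0ℚ * 1ℚ) 1ℚ)
  jet-at (suc n) = subst₂ (Jet _) (*-zeroˡ (- m * v)) eq
      (jet-* (binomial-jet n) (jet-linear (- m * v) v))
    where
    m = fromℕ (suc n)
    u = ℤ.+ 1 / suc n
    v = ℤ.+ 1 / suc (suc n)
    s = (- 1ℚ) ^ n
    eq : s * u * (- m * v) + 0ℚ * v ≡ (- 1ℚ) * s * v
    eq = trans (S.solve 4 (λ s m u v → s :* u :* (:- m :* v) :+ con 0ℚ :* v :=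
          :- con 1ℚ :* s :* v :* (m :* u)) refl s m u v)
      (trans (cong ((- 1ℚ) * s * v *_) (fromℕ-1/ (suc n))) (*-identityʳ _))

newton : ℕ → (ℕ → ℚ) → ℕ → ℚ
newton zero    c t = c 0
newton (suc L) c t = newton L c t + c (suc L) * binomial (suc L) t

newton-0 : ∀ L c → newton L c 0 ≡ c 0
newton-0 zero    c = refl
newton-0 (suc L) c = trans (cong₂ (λ x y → x + c (suc L) * y) (newton-0 L c) (binomial-0 L))
  (trans (cong (c 0 +_) (*-zeroʳ (c (suc L)))) (+-identityʳ (c 0)))

-- By Pascal's rule, differencing a Newton series shifts its coefficient sequence by one.
newton-suc : ∀ L c t → newton (suc L) c (suc t) ≡ newton (suc L) c t + newton L (λ n → c (suc n)) t
newton-suc zero    c t = trans (cong (λ x → c 0 + c 1 * x) (pascal 0 t))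
  (S.solve 3 (λ a b x → a :+ b :* (x :+ con 1ℚ) := (a :+ b :* x) :+ b) refl (c 0) (c 1) (binomial 1 t))
newton-suc (suc L) c t = trans (cong₂ (λ x y → x + c (suc (suc L)) * y) (newton-suc L c t) (pascal (suc L) t))
  (S.solve 5 (λ x y c b b′ → (x :+ y) :+ c :* (b :+ b′) := (x :+ c :* b) :+ (y :+ c :* b′)) refl
    (newton (suc L) c t) (newton L (λ n → c (suc n)) t) (c (suc (suc L)))
    (binomial (suc (suc L)) t) (binomial (suc L) t))

newton-integrate : ∀ L c → f 0 ≡ c 0 → (∀ t → f (suc t) ≡ f t + newton L (λ n → c (suc n)) t) →
                   ∀ t → f t ≡ newton (suc L) c t
newton-integrate {f} L c eq₀ eq zero    = trans eq₀ (sym (newton-0 (suc L) c))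
newton-integrate {f} L c eq₀ eq (suc t) = trans (eq t)
  (trans (cong (_+ newton L (λ n → c (suc n)) t) (newton-integrate {f} L c eq₀ eq t)) (sym (newton-suc L c t)))

-- `φ n` is the n-th difference of `φ 0` in t. Both sides agree at t = 0, and their differences
-- agree by induction on `L`.
newton-expansion : ∀ L (φ : ℕ → ℕ → ℚ) → (∀ n t → φ n (suc t) ≡ φ n t + φ (suc n) t) →
                   (∀ t → φ (suc L) t ≡ 0ℚ) → ∀ t → φ 0 t ≡ newton L (λ n → φ n 0) t
newton-expansion zero    φ rec van zero    = refl
newton-expansion zero    φ rec van (suc t) = trans (rec 0 t)
  (trans (cong₂ _+_ (newton-expansion zero φ rec van t) (van t)) (+-identityʳ (φ 0 0)))
newton-expansion (suc L) φ rec van = newton-integrate {φ 0} L (λ n → φ n 0) refl λ t →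
  trans (rec 0 t) (cong (φ 0 t +_) (newton-expansion L (λ n → φ (suc n)) (λ n → rec (suc n)) van t))

-- The linear coefficient is written exactly as the sum in the definition of `log`, with `c n` in
-- place of the coefficient of the n-th power.
newton-jet : ∀ L c → Jet (newton L c) (c 0) (sumTo _+_ 0ℚ (λ n → (- 1ℚ) ^ pred n * (ℤ.+ 1 / n) * c n) L)
newton-jet zero    c = jet-const (c 0)
newton-jet (suc L) c = subst₂ (Jet _)
  (trans (cong (c 0 +_) (*-zeroʳ (c (suc L)))) (+-identityʳ (c 0)))
  (cong (sumTo _+_ 0ℚ (λ n → (- 1ℚ) ^ pred n * (ℤ.+ 1 / n) * c n) L +_)
    (S.solve 2 (λ c b → con 0ℚ :* con 0ℚ :+ c :* b := b :* c) refl (c (suc L)) ((- 1ℚ) ^ L * (ℤ.+ 1 / suc L))))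
  (jet-+ (newton-jet L c) (jet-* (jet-const (c (suc L))) (binomial-jet L)))

-- Integrating from the constant top difference downwards yields a Newton series whose coefficients
-- are the values at 0 of the successive differences.
difference-polynomial : Difference d f c → IsPolynomial f
difference-polynomial {d} {f} D = let c , eq = expand D in
  polynomial-cong (λ t → sym (eq t)) (jet-polynomial (newton-jet d c))
  where
  expand : ∀ {d f a} → Difference d f a → ∃ λ c → ∀ t → f t ≡ newton d c t
  expand {a = a} (constant eq) = (λ _ → a) , λ t → eq t
  expand {suc d} {f} (step eq D) = let c , eq′ = expand D in
    prepend c , newton-integrate {f} d (prepend c) refl (λ t → trans (eq t) (cong (f t +_) (eq′ t)))
    where
    prepend : (ℕ → ℚ) → ℕ → ℚ
    prepend c zero    = f 0
    prepend c (suc n) = c n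

-- Group-like series and the logarithm

pairing-++ : ∀ S p q → ⟨ S ∣ p +ᴾ q ⟩ ≡ ⟨ S ∣ p ⟩ + ⟨ S ∣ q ⟩
pairing-++ S []            q = sym (+-identityˡ ⟨ S ∣ q ⟩)
pairing-++ S ((c , w) ∷ p) q = trans (cong (c * S w +_) (pairing-++ S p q))
  (sym (+-assoc (c * S w) ⟨ S ∣ p ⟩ ⟨ S ∣ q ⟩))

pairing-scale : ∀ S c p → ⟨ S ∣ scale c p ⟩ ≡ c * ⟨ S ∣ p ⟩
pairing-scale S c []            = sym (*-zeroʳ c)
pairing-scale S c ((b , w) ∷ p) = trans (cong (c * b * S w +_) (pairing-scale S c p))
  (S.solve 4 (λ c b s p → c :* b :* s :+ c :* p := c :* (b :* s :+ p)) refl c b (S w) ⟨ S ∣ p ⟩)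

pairing-prefix : ∀ S s p → ⟨ S ∣ prefix s p ⟩ ≡ ⟨ (λ w → S (s ∷ w)) ∣ p ⟩
pairing-prefix S s []            = refl
pairing-prefix S s ((c , w) ∷ p) = cong (c * S (s ∷ w) +_) (pairing-prefix S s p)

pairing-cong : (∀ w → R w ≡ T w) → ∀ p → ⟨ R ∣ p ⟩ ≡ ⟨ T ∣ p ⟩
pairing-cong h []            = refl
pairing-cong h ((c , w) ∷ p) = cong₂ (λ x y → c * x + y) (h w) (pairing-cong h p)

pairing-linear : ∀ k → (∀ w → U w ≡ R w + k * T w) → ∀ p → ⟨ U ∣ p ⟩ ≡ ⟨ R ∣ p ⟩ + k * ⟨ T ∣ p ⟩
pairing-linear k h [] = sym (trans (+-identityˡ (k * 0ℚ)) (*-zeroʳ k))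
pairing-linear {U} {R} {T} k h ((c , w) ∷ p) =
  trans (cong₂ (λ x y → c * x + y) (h w) (pairing-linear {U} {R} {T} k h p))
    (S.solve 6 (λ c k r t p q → c :* (r :+ k :* t) :+ (p :+ k :* q) :=
        (c :* r :+ p) :+ k :* (c :* t :+ q)) refl
      c k (R w) (T w) ⟨ R ∣ p ⟩ ⟨ T ∣ p ⟩)

pairing-word : ∀ S w → ⟨ S ∣ (1ℚ , w) ∷ [] ⟩ ≡ S w
pairing-word S w = trans (+-identityʳ (1ℚ * S w)) (*-identityˡ (S w))

-- Left multiplication by 1 + ∑ₛ nˢ yₛ.
extend : ℕ → Series ℚ → Series ℚ
extend n T []      = T []
extend n T (s ∷ w) = T (s ∷ w) + fromℕ (n ℕ.^ s) * T w

-- Expanding E(y_i u) E(y_j v) gives four products. The one without new factors is the group-like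
-- identity of `T`; the other three match the three terms of the quasi-shuffle recursion, the last
-- one because s ↦ n^s turns sums into products.
extend-groupLike : ∀ n → GroupLike T → GroupLike (extend n T)
extend-groupLike {T} n (T[]≡1 , Δ≡) = T[]≡1 , comultiplicative
  where
  E = extend n T
  x : ℕ → ℚ
  x s = fromℕ (n ℕ.^ s)
  prefixed : ∀ s p → ⟨ E ∣ prefix s p ⟩ ≡ ⟨ T ∣ prefix s p ⟩ + x s * ⟨ T ∣ p ⟩
  prefixed s p = trans (pairing-prefix E s p)
    (trans (pairing-linear {λ w → E (s ∷ w)} {λ w → T (s ∷ w)} {T} (x s) (λ _ → refl) p)
      (cong (_+ x s * ⟨ T ∣ p ⟩) (sym (pairing-prefix T s p))))
  comultiplicative : Δ E ≗² E ⊗ E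
  comultiplicative []      v  = trans (pairing-word E v)
    (sym (trans (cong (_* E v) T[]≡1) (*-identityˡ (E v))))
  comultiplicative (i ∷ u) [] = trans (pairing-word E (i ∷ u))
    (sym (trans (cong (E (i ∷ u) *_) T[]≡1) (*-identityʳ (E (i ∷ u)))))
  comultiplicative (i ∷ u) (j ∷ v) = begin
    ⟨ E ∣ prefix i p₁ +ᴾ prefix j p₂ +ᴾ prefix (i ℕ.+ j) p₃ ⟩
      ≡⟨ pairing-⋆ E ⟩
    ⟨ E ∣ prefix i p₁ ⟩ + ⟨ E ∣ prefix j p₂ ⟩ + ⟨ E ∣ prefix (i ℕ.+ j) p₃ ⟩
      ≡⟨ cong₂ _+_ (cong₂ _+_ (prefixed i p₁) (prefixed j p₂)) (prefixed (i ℕ.+ j) p₃) ⟩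
    (A₁ + x i * ⟨ T ∣ p₁ ⟩) + (A₂ + x j * ⟨ T ∣ p₂ ⟩) + (A₃ + x (i ℕ.+ j) * ⟨ T ∣ p₃ ⟩)
      ≡⟨ S.solve 6 (λ a b c d e f → (a :+ d) :+ (b :+ e) :+ (c :+ f) := (a :+ b :+ c) :+ (d :+ e :+ f))
           refl A₁ A₂ A₃ (x i * ⟨ T ∣ p₁ ⟩) (x j * ⟨ T ∣ p₂ ⟩) (x (i ℕ.+ j) * ⟨ T ∣ p₃ ⟩) ⟩
    (A₁ + A₂ + A₃) + (x i * ⟨ T ∣ p₁ ⟩ + x j * ⟨ T ∣ p₂ ⟩ + x (i ℕ.+ j) * ⟨ T ∣ p₃ ⟩)
      ≡⟨ cong₂ _+_ (trans (sym (pairing-⋆ T)) (Δ≡ (i ∷ u) (j ∷ v)))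
           (cong₂ _+_ (cong₂ (λ a b → x i * a + x j * b) (Δ≡ u (j ∷ v)) (Δ≡ (i ∷ u) v))
             (cong₂ _*_ power (Δ≡ u v))) ⟩
    T (i ∷ u) * T (j ∷ v) +
    (x i * (T u * T (j ∷ v)) + x j * (T (i ∷ u) * T v) + x i * x j * (T u * T v))
      ≡⟨ S.solve 6 (λ a b c d x y → a :* b :+ (x :* (c :* b) :+ y :* (a :* d) :+ x :* y :* (c :* d)) :=
           (a :+ x :* c) :* (b :+ y :* d)) refl
           (T (i ∷ u)) (T (j ∷ v)) (T u) (T v) (x i) (x j) ⟩
    E (i ∷ u) * E (j ∷ v) ∎
    where
    open ≡-Reasoning
    p₁ = u ⋆ʷ (j ∷ v)
    p₂ = (i ∷ u) ⋆ʷ v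
    p₃ = u ⋆ʷ v
    A₁ = ⟨ T ∣ prefix i p₁ ⟩
    A₂ = ⟨ T ∣ prefix j p₂ ⟩
    A₃ = ⟨ T ∣ prefix (i ℕ.+ j) p₃ ⟩
    pairing-⋆ : ∀ S → ⟨ S ∣ prefix i p₁ +ᴾ prefix j p₂ +ᴾ prefix (i ℕ.+ j) p₃ ⟩ ≡
            ⟨ S ∣ prefix i p₁ ⟩ + ⟨ S ∣ prefix j p₂ ⟩ + ⟨ S ∣ prefix (i ℕ.+ j) p₃ ⟩
    pairing-⋆ S = trans (pairing-++ S (prefix i p₁ +ᴾ prefix j p₂) (prefix (i ℕ.+ j) p₃))
      (cong (_+ ⟨ S ∣ prefix (i ℕ.+ j) p₃ ⟩) (pairing-++ S (prefix i p₁) (prefix j p₂)))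
    power : x (i ℕ.+ j) ≡ x i * x j
    power = trans (cong fromℕ (ℕ.^-distribˡ-+-* n i j)) (fromℕ-* (n ℕ.^ i) (n ℕ.^ j))

1ˢ-groupLike : GroupLike 1ˢ
1ˢ-groupLike = refl , comultiplicative
  where
  vanish : ∀ s p → ⟨ 1ˢ ∣ prefix s p ⟩ ≡ 0ℚ
  vanish s []            = refl
  vanish s ((c , w) ∷ p) = trans (cong₂ _+_ (*-zeroʳ c) (vanish s p)) (+-identityʳ 0ℚ)
  comultiplicative : Δ 1ˢ ≗² 1ˢ ⊗ 1ˢ
  comultiplicative []      v  = trans (pairing-word 1ˢ v) (sym (*-identityˡ (1ˢ v)))
  comultiplicative (i ∷ u) [] = refl
  comultiplicative (i ∷ u) (j ∷ v) = trans
    (pairing-++ 1ˢ (prefix i p₁ +ᴾ prefix j p₂) (prefix (i ℕ.+ j) p₃))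
    (trans (cong₂ _+_ (trans (pairing-++ 1ˢ (prefix i p₁) (prefix j p₂))
        (cong₂ _+_ (vanish i p₁) (vanish j p₂))) (vanish (i ℕ.+ j) p₃))
      refl)
    where
    p₁ = u ⋆ʷ (j ∷ v)
    p₂ = (i ∷ u) ⋆ʷ v
    p₃ = u ⋆ʷ v

-- Left multiplication by H⁻ N, factored as ∏_{n = N, …, 1} (1 + ∑ₛ nˢ yₛ).
act : ℕ → Series ℚ → Series ℚ
act zero    T = T
act (suc N) T = extend (suc N) (act N T)

act-groupLike : ∀ N → GroupLike T → GroupLike (act N T)
act-groupLike zero    G = G
act-groupLike (suc N) G = extend-groupLike (suc N) (act-groupLike N G)

H⁻-suc : ∀ N w → H⁻ (suc N) w ≡ extend (suc N) (H⁻ N) w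
H⁻-suc N []      = refl
H⁻-suc N (s ∷ w) = trans (fromℕ-+ (H (s ∷ w) N) (suc N ℕ.^ s ℕ.* H w N))
  (cong (H⁻ N (s ∷ w) +_) (fromℕ-* (suc N ℕ.^ s) (H w N)))

extend-cong : ∀ n → (∀ w → R w ≡ T w) → ∀ w → extend n R w ≡ extend n T w
extend-cong n h []      = h []
extend-cong n h (s ∷ w) = cong₂ (λ x y → x + fromℕ (n ℕ.^ s) * y) (h (s ∷ w)) (h w)

act-1ˢ : ∀ N w → act N 1ˢ w ≡ H⁻ N w
act-1ˢ zero    []      = refl
act-1ˢ zero    (s ∷ w) = refl
act-1ˢ (suc N) w = trans (extend-cong (suc N) (act-1ˢ N) w) (sym (H⁻-suc N w))

groupLike-cong : (∀ w → R w ≡ T w) → GroupLike R → GroupLike T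
groupLike-cong {R} {T} h (R[]≡1 , Δ≡) = trans (sym (h [])) R[]≡1 , λ u v →
  trans (sym (pairing-cong h (u ⋆ʷ v))) (trans (Δ≡ u v) (cong₂ _*_ (h u) (h v)))

H⁻-groupLike : ∀ N → GroupLike (H⁻ N)
H⁻-groupLike N = groupLike-cong (act-1ˢ N) (act-groupLike N 1ˢ-groupLike)

-- Concatenation products and powers of H⁻(N)

·-∷ : ∀ S T s w → (S · T) (s ∷ w) ≡ S [] * T (s ∷ w) + ((λ v → S (s ∷ v)) · T) w
·-∷ S T s w = cong (λ l → S [] * T (s ∷ w) + sumℚ l) (sym (map-∘ (factorizations w)))

·-cong : (∀ w → R w ≡ T w) → ∀ U w → (R · U) w ≡ (T · U) w
·-cong {R} {T} h U w = go (factorizations w)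
  where
  go : ∀ l → sumℚ (map (λ (u , v) → R u * U v) l) ≡ sumℚ (map (λ (u , v) → T u * U v) l)
  go []            = refl
  go ((u , v) ∷ l) = cong₂ (λ x y → x * U v + y) (h u) (go l)

·-linear : ∀ k → (∀ w → U w ≡ R w + k * T w) → ∀ V w → (U · V) w ≡ (R · V) w + k * (T · V) w
·-linear {U} {R} {T} k h V w = go (factorizations w)
  where
  go : ∀ l → sumℚ (map (λ (u , v) → U u * V v) l) ≡
             sumℚ (map (λ (u , v) → R u * V v) l) + k * sumℚ (map (λ (u , v) → T u * V v) l)
  go []            = sym (trans (+-identityˡ (k * 0ℚ)) (*-zeroʳ k))
  go ((u , v) ∷ l) = trans (cong₂ (λ x y → x * V v + y) (h u) (go l))
    (S.solve 6 (λ v k r t p q → (r :+ k :* t) :* v :+ (p :+ k :* q) :=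
        (r :* v :+ p) :+ k :* (t :* v :+ q)) refl
      (V v) k (R u) (T u) (sumℚ (map (λ (u , v) → R u * V v) l)) (sumℚ (map (λ (u , v) → T u * V v) l)))

0·T : ∀ T w → ((λ _ → 0ℚ) · T) w ≡ 0ℚ
0·T T w = go (factorizations w)
  where
  go : ∀ l → sumℚ (map (λ (u , v) → 0ℚ * T v) l) ≡ 0ℚ
  go []            = refl
  go ((u , v) ∷ l) = trans (cong₂ _+_ (*-zeroˡ (T v)) (go l)) (+-identityʳ 0ℚ)

1·T : ∀ T w → (1ˢ · T) w ≡ T w
1·T T []      = trans (+-identityʳ (1ℚ * T [])) (*-identityˡ (T []))
1·T T (s ∷ w) = trans (·-∷ 1ˢ T s w)
  (trans (cong₂ _+_ (*-identityˡ (T (s ∷ w))) (0·T T w)) (+-identityʳ (T (s ∷ w))))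

extend-· : ∀ n R T w → (extend n R · T) w ≡ extend n (R · T) w
extend-· n R T []      = refl
extend-· n R T (s ∷ w) = trans (·-∷ (extend n R) T s w)
  (trans (cong (R [] * T (s ∷ w) +_)
      (·-linear {λ v → extend n R (s ∷ v)} {λ v → R (s ∷ v)} {R} k (λ _ → refl) T w))
    (trans (sym (+-assoc (R [] * T (s ∷ w)) (((λ v → R (s ∷ v)) · T) w) (k * (R · T) w)))
      (cong (_+ k * (R · T) w) (sym (·-∷ R T s w)))))
  where k = fromℕ (n ℕ.^ s)

-- The instance of associativity that is needed: the left factors 1 + ∑ₛ nˢ yₛ commute with right
-- multiplication by `T`.
act-H⁻ : ∀ N T w → act N T w ≡ (H⁻ N · T) w
act-H⁻ zero    T w = sym (trans (·-cong (λ v → sym (act-1ˢ 0 v)) T w) (1·T T w))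
act-H⁻ (suc N) T w = trans (extend-cong (suc N) (act-H⁻ N T) w)
  (trans (sym (extend-· (suc N) (H⁻ N) T w)) (·-cong (λ v → sym (H⁻-suc N v)) T w))

extend-+ : ∀ n → (∀ w → U w ≡ R w + T w) → ∀ w → extend n U w ≡ extend n R w + extend n T w
extend-+ n h [] = h []
extend-+ {U} {R} {T} n h (s ∷ w) = trans (cong₂ (λ x y → x + fromℕ (n ℕ.^ s) * y) (h (s ∷ w)) (h w))
  (S.solve 5 (λ a b k c d → (a :+ b) :+ k :* (c :+ d) := (a :+ k :* c) :+ (b :+ k :* d)) refl
    (R (s ∷ w)) (T (s ∷ w)) (fromℕ (n ℕ.^ s)) (R w) (T w))

act-+ : ∀ N → (∀ w → U w ≡ R w + T w) → ∀ w → act N U w ≡ act N R w + act N T w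
act-+ zero    h = h
act-+ {U} {R} {T} (suc N) h = extend-+ {act N U} {act N R} {act N T} (suc N) (act-+ {U} {R} {T} N h)

VanishesBelow : ℕ → Series ℚ → Set
VanishesBelow m T = ∀ w → length w ℕ.< m → T w ≡ 0ℚ

extend-vanishes : ∀ n {m} → VanishesBelow m T → VanishesBelow m (extend n T)
extend-vanishes n v []      l = v [] l
extend-vanishes n v (s ∷ w) l = trans
  (cong₂ (λ x y → x + fromℕ (n ℕ.^ s) * y) (v (s ∷ w) l) (v w (ℕ.<-trans (ℕ.n<1+n (length w)) l)))
  (trans (+-identityˡ (fromℕ (n ℕ.^ s) * 0ℚ)) (*-zeroʳ (fromℕ (n ℕ.^ s))))

act-vanishes : ∀ N {m} → VanishesBelow m T → VanishesBelow m (act N T)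
act-vanishes zero    v = v
act-vanishes {T} (suc N) v = extend-vanishes {act N T} (suc N) (act-vanishes {T} N v)

·-vanishes : ∀ R {m} → VanishesBelow m T → VanishesBelow m (R · T)
·-vanishes {T} R v []      l = trans (cong (λ x → R [] * x + 0ℚ) (v [] l))
  (trans (+-identityʳ (R [] * 0ℚ)) (*-zeroʳ (R [])))
·-vanishes {T} R v (s ∷ w) l = trans (·-∷ R T s w)
  (trans (cong₂ (λ x y → R [] * x + y) (v (s ∷ w) l)
      (·-vanishes {T} (λ u → R (s ∷ u)) v w (ℕ.<-trans (ℕ.n<1+n (length w)) l)))
    (trans (+-identityʳ (R [] * 0ℚ)) (*-zeroʳ (R []))))

-- Each factor lacks a constant term and so takes at least one letter of the word.
^ˢ-vanishes : ∀ R → R [] ≡ 0ℚ → ∀ n → VanishesBelow n (R ^ˢ n)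
^ˢ-vanishes R R[]≡0 zero    w       ()
^ˢ-vanishes R R[]≡0 (suc n) []      l = trans (cong (λ x → x * (R ^ˢ n) [] + 0ℚ) R[]≡0)
  (trans (+-identityʳ (0ℚ * (R ^ˢ n) [])) (*-zeroˡ ((R ^ˢ n) [])))
^ˢ-vanishes R R[]≡0 (suc n) (s ∷ w) l = trans (·-∷ R (R ^ˢ n) s w)
  (trans (cong₂ (λ x y → x * (R ^ˢ n) (s ∷ w) + y) R[]≡0
      (·-vanishes {R ^ˢ n} (λ u → R (s ∷ u)) (^ˢ-vanishes R R[]≡0 n) w (ℕ.s<s⁻¹ l)))
    (trans (+-identityʳ (0ℚ * (R ^ˢ n) (s ∷ w))) (*-zeroˡ ((R ^ˢ n) (s ∷ w)))))

-- This is H⁻(N)ᵗ · T. Applying `act` innermost lets the recurrence in t follow from linearity once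
-- `act N T` is split as T + X · T.
iterate : ℕ → ℕ → Series ℚ → Series ℚ
iterate N zero    T = T
iterate N (suc t) T = iterate N t (act N T)

iterate-groupLike : ∀ N t → GroupLike T → GroupLike (iterate N t T)
iterate-groupLike N zero    G = G
iterate-groupLike N (suc t) G = iterate-groupLike N t (act-groupLike N G)

iterate-+ : ∀ N t → (∀ w → U w ≡ R w + T w) → ∀ w → iterate N t U w ≡ iterate N t R w + iterate N t T w
iterate-+ N zero    h = h
iterate-+ {U} {R} {T} N (suc t) h =
  iterate-+ {act N U} {act N R} {act N T} N t (act-+ {U} {R} {T} N h)

iterate-vanishes : ∀ N t {m} → VanishesBelow m T → VanishesBelow m (iterate N t T)
iterate-vanishes N zero    v = v
iterate-vanishes {T} N (suc t) v = iterate-vanishes {act N T} N t (act-vanishes {T} N v)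

module LogIsPrimitive (N : ℕ) where
  X : Series ℚ
  X v = H⁻ N v - 1ˢ v

  act-X : ∀ T w → act N T w ≡ T w + (X · T) w
  act-X T w = trans (act-H⁻ N T w)
    (trans (·-linear {H⁻ N} {1ˢ} {X} 1ℚ
        (λ v → S.solve 2 (λ h e → h := e :+ con 1ℚ :* (h :- e)) refl (H⁻ N v) (1ˢ v)) T w)
      (cong₂ _+_ (1·T T w) (*-identityˡ ((X · T) w))))

  -- Differencing t ↦ H⁻(N)ᵗ multiplies it by X, so log is its linear coefficient.
  power-jet : ∀ w → Jet (λ t → iterate N t 1ˢ w) (1ˢ w) (log (H⁻ N) w)
  power-jet w = jet-cong (λ t → sym (newton-expansion (length w) φ recurrence
      -- The power |w| + 1 of `X` vanishes at `w`, so the Newton series stops at |w|, just where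
      -- `log` is truncated.
      (λ t → iterate-vanishes {X ^ˢ suc (length w)} N t
        (^ˢ-vanishes X (+-inverseʳ 1ℚ) (suc (length w))) w (ℕ.n<1+n (length w))) t))
      (newton-jet (length w) (λ n → (X ^ˢ n) w))
    where
    φ : ℕ → ℕ → ℚ
    φ n t = iterate N t (X ^ˢ n) w
    recurrence : ∀ n t → φ n (suc t) ≡ φ n t + φ (suc n) t
    recurrence n t = iterate-+ {act N (X ^ˢ n)} {X ^ˢ n} {X ^ˢ suc n} N t (act-X (X ^ˢ n)) w

  pairing-jet : ∀ p → Jet (λ t → ⟨ iterate N t 1ˢ ∣ p ⟩) ⟨ 1ˢ ∣ p ⟩ ⟨ log (H⁻ N) ∣ p ⟩
  pairing-jet []            = jet-const 0ℚ
  pairing-jet ((c , w) ∷ p) = jet-+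
    (subst (Jet (λ t → c * iterate N t 1ˢ w) (c * 1ˢ w))
      (trans (cong (_+ c * log (H⁻ N) w) (*-zeroˡ (1ˢ w))) (+-identityˡ (c * log (H⁻ N) w)))
      (jet-* (jet-const c) (power-jet w)))
    (pairing-jet p)

  -- The product rule for jets turns the right side of the group-like identity for H⁻(N)ᵗ into log ⊗
  -- 1 + 1 ⊗ log; uniqueness of the linear coefficient does the rest.
  log-primitive : Primitive (log (H⁻ N))
  log-primitive u v = jet-unique (pairing-jet (u ⋆ʷ v))
    (jet-cong (λ t → sym (proj₂ (iterate-groupLike N t 1ˢ-groupLike) u v))
      (jet-* (power-jet u) (power-jet v)))

-- The kernel

-- A group-like series is a character of the quasi-shuffle algebra: its defining identity on words
-- extends bilinearly.
pairing-⋆ : GroupLike T → ∀ p q → ⟨ T ∣ p ⋆ q ⟩ ≡ ⟨ T ∣ p ⟩ * ⟨ T ∣ q ⟩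
pairing-⋆ {T} (_ , Δ≡) = go
  where
  row : ∀ a u q → ⟨ T ∣ concatMap (λ (b , v) → scale (a * b) (u ⋆ʷ v)) q ⟩ ≡ a * T u * ⟨ T ∣ q ⟩
  row a u []            = sym (*-zeroʳ (a * T u))
  row a u ((b , v) ∷ q) = trans (pairing-++ T (scale (a * b) (u ⋆ʷ v)) _)
    (trans (cong₂ _+_ (trans (pairing-scale T (a * b) (u ⋆ʷ v)) (cong (a * b *_) (Δ≡ u v))) (row a u q))
      (S.solve 5 (λ a b u v q → a :* b :* (u :* v) :+ a :* u :* q := a :* u :* (b :* v :+ q)) refl
        a b (T u) (T v) ⟨ T ∣ q ⟩))
  go : ∀ p q → ⟨ T ∣ p ⋆ q ⟩ ≡ ⟨ T ∣ p ⟩ * ⟨ T ∣ q ⟩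
  go []            q = sym (*-zeroˡ ⟨ T ∣ q ⟩)
  go ((a , u) ∷ p) q = trans
    (pairing-++ T (concatMap (λ (b , v) → scale (a * b) (u ⋆ʷ v)) q) (p ⋆ q))
    (trans (cong₂ _+_ (row a u q) (go p q)) (sym (*-distribʳ-+ ⟨ T ∣ q ⟩ (a * T u) ⟨ T ∣ p ⟩)))

-- Independence of the representation of a polynomial

without : Word → Polynomial → Polynomial
without w = filter (λ x → ¬? (≡-dec ℕ._≟_ w (proj₂ x)))

pairing-without : ∀ T w p → ⟨ T ∣ p ⟩ ≡ coefficient w p * T w + ⟨ T ∣ without w p ⟩
pairing-without T w [] = sym (trans (+-identityʳ (0ℚ * T w)) (*-zeroˡ (T w)))
pairing-without T w ((c , v) ∷ p) with ≡-dec ℕ._≟_ w v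
... | yes refl = trans (cong (c * T w +_) (pairing-without T w p))
  (S.solve 4 (λ c t k r → c :* t :+ (k :* t :+ r) := (c :* con 1ℚ :+ k) :* t :+ r) refl
    c (T w) (coefficient w p) ⟨ T ∣ without w p ⟩)
... | no _ = trans (cong (c * T v +_) (pairing-without T w p))
  (S.solve 5 (λ c s t k r → c :* s :+ (k :* t :+ r) := (c :* con 0ℚ :+ k) :* t :+ (c :* s :+ r)) refl
    c (T v) (T w) (coefficient w p) ⟨ T ∣ without w p ⟩)

-- Recovers the series that is local to `coefficient`, so that the lemmas on pairings apply to
-- coefficients.
indicator : Word → Series ℚ
indicator w v = coefficient w ((1ℚ , v) ∷ [])

coefficient-pairing : ∀ w p → coefficient w p ≡ ⟨ indicator w ∣ p ⟩
coefficient-pairing w []            = refl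
coefficient-pairing w ((c , v) ∷ p) with ≡-dec ℕ._≟_ w v
... | yes _ = cong (c * 1ℚ +_) (coefficient-pairing w p)
... | no  _ = cong (c * 0ℚ +_) (coefficient-pairing w p)

coefficient-without : ∀ w p → p ≋ 0ᴾ → without w p ≋ 0ᴾ
coefficient-without w p p≋0 v = begin
  coefficient v p′                                       ≡⟨ coefficient-pairing v p′ ⟩
  ⟨ indicator v ∣ p′ ⟩                                   ≡⟨ sym (+-identityˡ ⟨ indicator v ∣ p′ ⟩) ⟩
  0ℚ + ⟨ indicator v ∣ p′ ⟩                              ≡⟨ cong (_+ ⟨ indicator v ∣ p′ ⟩)
                                                             (sym (*-zeroˡ (indicator v w))) ⟩
  0ℚ * indicator v w + ⟨ indicator v ∣ p′ ⟩              ≡⟨ cong (λ k → k * indicator v w + ⟨ indicator v ∣ p′ ⟩)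
                                                             (sym (p≋0 w)) ⟩
  coefficient w p * indicator v w + ⟨ indicator v ∣ p′ ⟩ ≡⟨ sym (pairing-without (indicator v) w p) ⟩
  ⟨ indicator v ∣ p ⟩                                    ≡⟨ sym (coefficient-pairing v p) ⟩
  coefficient v p                                        ≡⟨ p≋0 v ⟩
  0ℚ                                                     ∎
  where
  open ≡-Reasoning
  p′ = without w p

-- A word may occur several times in the list, so all its occurrences are collected at once into its
-- coefficient, which is 0. The remaining list is not a sublist by pattern matching, whence the
-- induction on a bound for the length.
pairing-zero : ∀ T p → p ≋ 0ᴾ → ⟨ T ∣ p ⟩ ≡ 0ℚ
pairing-zero T p = bounded-length (length p) p ℕ.≤-refl
  where
  bounded-length : ∀ n p → length p ℕ.≤ n → p ≋ 0ᴾ → ⟨ T ∣ p ⟩ ≡ 0ℚ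
  bounded-length n       []                _         p≋0 = refl
  bounded-length (suc n) p@((c , w) ∷ p′) (ℕ.s≤s l) p≋0 = trans (pairing-without T w p)
    (trans (cong₂ (λ k r → k * T w + r) (p≋0 w)
        (bounded-length n (without w p) shorter (coefficient-without w p p≋0)))
      (trans (+-identityʳ (0ℚ * T w)) (*-zeroˡ (T w))))
    where
    shorter : length (without w p) ℕ.≤ n
    shorter = subst (ℕ._≤ n)
      (cong length (sym (filter-reject (λ x → ¬? (≡-dec ℕ._≟_ w (proj₂ x))) {c , w} {p′} λ w≢w → w≢w refl)))
      (ℕ.≤-trans (length-filter (λ x → ¬? (≡-dec ℕ._≟_ w (proj₂ x))) p′) l)

pairing-resp : ∀ T p q → p ≋ q → ⟨ T ∣ p ⟩ ≡ ⟨ T ∣ q ⟩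
pairing-resp T p q p≋q = begin
  ⟨ T ∣ p ⟩                             ≡⟨ S.solve 2 (λ p q → p := (p :+ :- con 1ℚ :* q) :+ q) refl
                                             ⟨ T ∣ p ⟩ ⟨ T ∣ q ⟩ ⟩
  (⟨ T ∣ p ⟩ + - 1ℚ * ⟨ T ∣ q ⟩) + ⟨ T ∣ q ⟩ ≡⟨ cong (_+ ⟨ T ∣ q ⟩) (sym (difference T)) ⟩
  ⟨ T ∣ r ⟩ + ⟨ T ∣ q ⟩                 ≡⟨ cong (_+ ⟨ T ∣ q ⟩) (pairing-zero T r r≋0) ⟩
  0ℚ + ⟨ T ∣ q ⟩                        ≡⟨ +-identityˡ ⟨ T ∣ q ⟩ ⟩
  ⟨ T ∣ q ⟩                             ∎
  where
  open ≡-Reasoning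
  r = p +ᴾ scale (- 1ℚ) q
  difference : ∀ T → ⟨ T ∣ r ⟩ ≡ ⟨ T ∣ p ⟩ + - 1ℚ * ⟨ T ∣ q ⟩
  difference T = trans (pairing-++ T p (scale (- 1ℚ) q)) (cong (⟨ T ∣ p ⟩ +_) (pairing-scale T (- 1ℚ) q))
  r≋0 : r ≋ 0ᴾ
  r≋0 w = begin
    coefficient w r                                        ≡⟨ coefficient-pairing w r ⟩
    ⟨ indicator w ∣ r ⟩                                    ≡⟨ difference (indicator w) ⟩
    ⟨ indicator w ∣ p ⟩ + - 1ℚ * ⟨ indicator w ∣ q ⟩       ≡⟨ cong₂ (λ x y → x + - 1ℚ * y)
                                                                (sym (coefficient-pairing w p))
                                                                (sym (coefficient-pairing w q)) ⟩
    coefficient w p + - 1ℚ * coefficient w q               ≡⟨ cong (λ x → x + - 1ℚ * coefficient w q) (p≋q w) ⟩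
    coefficient w q + - 1ℚ * coefficient w q               ≡⟨ S.solve 1 (λ x → x :+ :- con 1ℚ :* x := con 0ℚ) refl
                                                                (coefficient w q) ⟩
    0ℚ                                                     ∎

H⁻-polynomial : ∀ p → IsPolynomial (λ N → ⟨ H⁻ N ∣ p ⟩)
H⁻-polynomial []            = polynomial-const 0ℚ
H⁻-polynomial ((c , w) ∷ p) =
  polynomial-+ (polynomial-scale c (difference-polynomial (H-difference w))) (H⁻-polynomial p)

ker-H⁻-prime : IsPrimeIdeal ker-H⁻
ker-H⁻-prime = record
  { resp      = λ {p} {q} p≋q p∈ker N → trans (sym (pairing-resp (H⁻ N) p q p≋q)) (p∈ker N)
  ; zeroᴾ     = λ N → refl
  ; +-closed  = λ {p} {q} p∈ker q∈ker N → trans (pairing-++ (H⁻ N) p q)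
      (trans (cong₂ _+_ (p∈ker N) (q∈ker N)) (+-identityʳ 0ℚ))
  ; ⋆-closedˡ = λ p {q} q∈ker N → trans (pairing-⋆ (H⁻-groupLike N) p q)
      (trans (cong (⟨ H⁻ N ∣ p ⟩ *_) (q∈ker N)) (*-zeroʳ ⟨ H⁻ N ∣ p ⟩))
  ; ⋆-closedʳ = λ {p} q p∈ker N → trans (pairing-⋆ (H⁻-groupLike N) p q)
      (trans (cong (_* ⟨ H⁻ N ∣ q ⟩) (p∈ker N)) (*-zeroˡ ⟨ H⁻ N ∣ q ⟩))
  ; proper    = λ 1∈ker → contradiction (1∈ker 0) λ ()
  -- The two pairings are polynomial in N with product zero, and `horner-domain` yields which of
  -- them vanishes.
  ; prime     = λ {p} {q} p∉ker q∉ker pq∈ker → Sum.[ p∉ker , q∉ker ]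
      (horner-domain 0 (horner (H⁻-polynomial p)) (horner (H⁻-polynomial q))
        (λ N _ → trans (sym (pairing-⋆ (H⁻-groupLike N) p q)) (pq∈ker N)))
  }
  where open IsPolynomial

-- The limits

archimedean-* : ∀ K {ε} → 0ℚ < ε → ∃ λ n → K ≤ ε * fromℕ n
archimedean-* K {ε} 0<ε =
  let i , 0<i , eq = recip ε 0<ε
      n , K/ε≤n = archimedean (i * K)
  in n , subst (_≤ ε * fromℕ n)
       (trans (sym (*-assoc ε i K)) (trans (cong (_* K) eq) (*-identityˡ K)))
       (*-monoˡ-≤-nonNeg ε {{nonNegative (<⇒≤ 0<ε)}} K/ε≤n)

∣-∣-≤-+ : ∀ p q → ∣ p - q ∣ ≤ ∣ p ∣ + ∣ q ∣
∣-∣-≤-+ p q = subst (∣ p - q ∣ ≤_) (cong (∣ p ∣ +_) (∣-p∣≡∣p∣ q)) (∣p+q∣≤∣p∣+∣q∣ p (- q))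

∣*∣-≤ : ∀ {p q a b} → ∣ p ∣ ≤ a → ∣ q ∣ ≤ b → ∣ p * q ∣ ≤ a * b
∣*∣-≤ {p} {q} {a} {b} p≤a q≤b =
  subst (_≤ a * b) (sym (∣p*q∣≡∣p∣*∣q∣ p q)) (*-mono (0≤∣p∣ p) p≤a (0≤∣p∣ q) q≤b)

∣nonNeg∣≤ : ∀ {p a} → 0ℚ ≤ p → p ≤ a → ∣ p ∣ ≤ a
∣nonNeg∣≤ {p} {a} 0≤p p≤a = subst (_≤ a) (sym (0≤p⇒∣p∣≡p 0≤p)) p≤a

-- The monomial n^d has d-th difference d!, so subtracting `C⁻` times it cancels the top difference.
-- The remainder then has order d - 1 and grows accordingly.
H-remainder : ∀ s w → ∃ λ K → 0ℚ ≤ K × ∀ n →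
  ∣ H⁻ (suc n) (s ∷ w) - C⁻ (s ∷ w) * fromℕ (suc n) ^ degree (s ∷ w) ∣
    ≤ K * fromℕ (suc n) ^ pred (degree (s ∷ w))
H-remainder s w = K , 0≤K , λ n →
  subst (λ x → ∣ x ∣ ≤ K * fromℕ (suc n) ^ m)
    (S.solve 3 (λ h c p → h :+ :- c :* p := h :- c :* p) refl
      (H⁻ (suc n) (s ∷ w)) C (fromℕ (suc n) ^ suc m))
    (hK n)
  where
  m = length w ℕ.+ (s ℕ.+ weight w)
  C = C⁻ (s ∷ w)
  monomial : Difference (suc m) (λ n → fromℕ n ^ suc m) (fromℕ (suc m !))
  monomial = difference-cong (λ n → *-identityʳ (fromℕ n ^ suc m))
    (subst₂ (λ d c → Difference d (λ n → fromℕ n ^ suc m * 1ℚ) c)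
      (ℕ.+-identityʳ (suc m))
      (trans (*-identityʳ _) (cong (λ k → fromℕ (k !)) (ℕ.+-identityʳ (suc m))))
      (difference-power fromℕ fromℕ-suc (suc m) (constant {f = λ _ → 1ℚ} {c = fromℕ (0 !) * 1ℚ} λ _ → refl)))
  remainder : Difference (suc m) (λ n → H⁻ n (s ∷ w) + - C * fromℕ n ^ suc m) 0ℚ
  remainder = subst (Difference (suc m) _)
    (S.solve 2 (λ f c → f :* c :+ :- c :* f := con 0ℚ) refl (fromℕ (suc m !)) C)
    (difference-+ (H-difference (s ∷ w)) (difference-scale (- C) monomial))
  -- Shifting the argument turns the growth bound into one by the power of the argument itself,
  -- `suc n`.
  growth = difference-growth (difference-shift (proj₂ (difference-lower remainder)))
  K = proj₁ growth
  0≤K = proj₁ (proj₂ growth)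
  hK = proj₂ (proj₂ growth)

-- Used with P = N^(d - 1), G = N^d and i = 1 / G. Multiplying the deviation by N P gives at most K
-- P; then P is cancelled and K compared with ε N.
ratio-bound : ∀ (N P G i H C K ε : ℚ) → 0ℚ < P → 0ℚ < N → G ≡ N * P → G * i ≡ 1ℚ →
  ∣ H - C * G ∣ ≤ K * P → K < ε * N → ∣ i * H - C ∣ < ε
ratio-bound N P G i H C K ε 0<P 0<N refl Gi bound K<εN =
  *-cancelʳ-<-nonNeg N {{nonNegative (<⇒≤ 0<N)}} (≤-<-trans
    (*-cancelʳ-≤-pos P {{positive 0<P}} (subst (_≤ K * P) eq bound)) K<εN)
  where
  y = i * H - C
  expand : y * (N * P) ≡ H - C * (N * P)
  expand = trans (S.solve 4 (λ i h c g → (i :* h :- c) :* g := (g :* i) :* h :- c :* g) refl i H C (N * P))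
    (trans (cong (λ t → t * H - C * (N * P)) Gi) (cong (_- C * (N * P)) (*-identityˡ H)))
  eq : ∣ H - C * (N * P) ∣ ≡ ∣ y ∣ * N * P
  eq = begin
    ∣ H - C * (N * P) ∣  ≡⟨ cong ∣_∣ (sym expand) ⟩
    ∣ y * (N * P) ∣      ≡⟨ ∣p*q∣≡∣p∣*∣q∣ y (N * P) ⟩
    ∣ y ∣ * ∣ N * P ∣    ≡⟨ cong (∣ y ∣ *_) (0≤p⇒∣p∣≡p (<⇒≤ (0<* 0<N 0<P))) ⟩
    ∣ y ∣ * (N * P)      ≡⟨ sym (*-assoc (∣ y ∣) N P) ⟩
    ∣ y ∣ * N * P        ∎
    where open ≡-Reasoning

normalisedH-limit : normalisedH ⟶∞ C⁻
normalisedH-limit []      ε 0<ε = 0 , λ N _ → 0<ε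
-- The choice of `n₀` gives K ≤ ε n₀; the extra one makes the inequality strict for N.
normalisedH-limit (s ∷ w) ε 0<ε = suc n₀ , large
  where
  K = proj₁ (H-remainder s w)
  hK = proj₂ (proj₂ (H-remainder s w))
  n₀ = proj₁ (archimedean-* K 0<ε)
  large : ∀ N .{{_ : ℕ.NonZero N}} → suc n₀ ℕ.≤ N → ∣ normalisedH N (s ∷ w) - C⁻ (s ∷ w) ∣ < ε
  large (suc N) (ℕ.s≤s n₀≤N) = ratio-bound (fromℕ (suc N)) (fromℕ (suc N) ^ pred (degree (s ∷ w)))
    (g (fromℕ (suc N)) (s ∷ w)) _ (H⁻ (suc N) (s ∷ w)) (C⁻ (s ∷ w)) K ε
    (0<^ (pred (degree (s ∷ w))) (0<fromℕ (suc N))) (0<fromℕ (suc N)) refl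
    (*-inverseʳ (g (fromℕ (suc N)) (s ∷ w)) {{≢-nonZero (g≢0 (suc N) (s ∷ w))}})
    (hK N)
    (≤-<-trans (proj₂ (archimedean-* K 0<ε)) (*-monoʳ-<-pos ε {{positive 0<ε}}
      (<-≤-trans (subst₂ _<_ (+-identityˡ (fromℕ n₀)) (sym (fromℕ-suc n₀)) (+-monoˡ-< (fromℕ n₀) 0<1))
        (fromℕ-mono (ℕ.s≤s n₀≤N)))))

-- Abel summation on truncated power series

partialSum : (ℕ → ℚ) → ℚ → ℕ → ℚ
partialSum f x zero    = 0ℚ
partialSum f x (suc M) = partialSum f x M + f M * x ^ M

partial≡ : ∀ a x M → partial a x M ≡ x * partialSum (λ n → fromℕ (a (suc n))) x M
partial≡ a x zero    = sym (*-zeroʳ x)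
partial≡ a x (suc M) = trans (cong (_+ fromℕ (a (suc M)) * (x * x ^ M)) (partial≡ a x M))
  (S.solve 4 (λ x s a p → x :* s :+ a :* (x :* p) := x :* (s :+ a :* p)) refl
    x (partialSum (λ n → fromℕ (a (suc n))) x M) (fromℕ (a (suc M))) (x ^ M))

-- The truncated form of (1 - x) ∑ f(n) xⁿ = f(0) + x ∑ f₁(n) xⁿ; the truncation leaves the boundary
-- term f(M) x^M.
summation-by-parts : (∀ n → f (suc n) ≡ f n + f₁ n) → ∀ x M →
  (1ℚ - x) * partialSum f x M + f M * x ^ M ≡ f 0 + x * partialSum f₁ x M
summation-by-parts {f} {f₁} eq x zero =
  S.solve 2 (λ x a → (con 1ℚ :- x) :* con 0ℚ :+ a :* con 1ℚ := a :+ x :* con 0ℚ) refl x (f 0)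
summation-by-parts {f} {f₁} eq x (suc M) = begin
  (1ℚ - x) * (P + f M * x ^ M) + f (suc M) * (x * x ^ M)
    ≡⟨ cong (λ t → (1ℚ - x) * (P + f M * x ^ M) + t * (x * x ^ M)) (eq M) ⟩
  (1ℚ - x) * (P + f M * x ^ M) + (f M + f₁ M) * (x * x ^ M)
    ≡⟨ S.solve 5 (λ x p a b y → (con 1ℚ :- x) :* (p :+ a :* y) :+ (a :+ b) :* (x :* y) :=
         ((con 1ℚ :- x) :* p :+ a :* y) :+ x :* (b :* y)) refl x P (f M) (f₁ M) (x ^ M) ⟩
  ((1ℚ - x) * P + f M * x ^ M) + x * (f₁ M * x ^ M)
    ≡⟨ cong (_+ x * (f₁ M * x ^ M)) (summation-by-parts {f} {f₁} eq x M) ⟩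
  (f 0 + x * partialSum f₁ x M) + x * (f₁ M * x ^ M)
    ≡⟨ S.solve 4 (λ a x p t → (a :+ x :* p) :+ x :* t := a :+ x :* (p :+ t)) refl
         (f 0) x (partialSum f₁ x M) (f₁ M * x ^ M) ⟩
  f 0 + x * (partialSum f₁ x M + f₁ M * x ^ M) ∎
  where
  open ≡-Reasoning
  P = partialSum f x M

partialSum-0 : ∀ x M → partialSum (λ _ → 0ℚ) x M ≡ 0ℚ
partialSum-0 x zero    = refl
partialSum-0 x (suc M) = trans (cong₂ _+_ (partialSum-0 x M) (*-zeroˡ (x ^ M))) (+-identityʳ 0ℚ)

-- One spare power is used: n^(d + 1) rⁿ is bounded, so n^d rⁿ is at most a constant divided by n.
-- This disposes of the boundary terms.
difference-decay : Difference d f c → ∀ r → 0ℚ < r → r < 1ℚ → ∀ ε → 0ℚ < ε →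
  ∃ λ M₀ → ∀ M → M₀ ℕ.≤ M → ∣ f M ∣ * r ^ M ≤ ε
difference-decay {d} {f} D r 0<r r<1 ε 0<ε =
  let K , 0≤K , hK = difference-growth (difference-shift D)
      B , 0<B , hB = Tame.bound (tame-n^ (suc d) tame-1) r 0<r r<1
      n₀ , hn₀ = archimedean-* (K * B) 0<ε
  in suc n₀ , decay K B n₀ 0≤K hK hB hn₀
  where
  decay : ∀ K B n₀ → 0ℚ ≤ K → (∀ n → ∣ f (suc n) ∣ ≤ K * fromℕ (suc n) ^ d) →
    (∀ n → fromℕ (n ℕ.^ suc d ℕ.* 1) * r ^ n ≤ B) → K * B ≤ ε * fromℕ n₀ →
    ∀ M → suc n₀ ℕ.≤ M → ∣ f M ∣ * r ^ M ≤ ε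
  decay K B n₀ 0≤K hK hB hn₀ (suc n) (ℕ.s≤s n₀≤n) = *-cancelʳ-≤-pos m {{positive (0<fromℕ (suc n))}}
    (≤-trans (*-monoʳ-≤-nonNeg m {{nonNegative (0≤fromℕ (suc n))}}
        (*-monoʳ-≤-nonNeg (r ^ suc n) {{nonNegative (<⇒≤ (0<^ (suc n) 0<r))}} (hK n)))
    (≤-trans (≤-reflexive (S.solve 4 (λ k p q m → k :* p :* q :* m := k :* (m :* p :* q)) refl
        K (m ^ d) (r ^ suc n) m))
    (≤-trans (*-monoˡ-≤-nonNeg K {{nonNegative 0≤K}}
        (subst (λ t → t * r ^ suc n ≤ B)
          (trans (cong fromℕ (ℕ.*-identityʳ (suc n ℕ.^ suc d))) (fromℕ-^ (suc n) (suc d))) (hB (suc n))))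
    (≤-trans hn₀ (*-monoˡ-≤-nonNeg ε {{nonNegative (<⇒≤ 0<ε)}}
        (fromℕ-mono (ℕ.≤-trans n₀≤n (ℕ.n≤1+n n))))))))
    where m = fromℕ (suc n)

module UnitInterval {x r : ℚ} (0≤x : 0ℚ ≤ x) (x≤r : x ≤ r) (r<1 : r < 1ℚ) where
  0<1-x : 0ℚ < 1ℚ - x
  0<1-x = <-diff (≤-<-trans x≤r r<1)

  ∣x∣≤1 : ∣ x ∣ ≤ 1ℚ
  ∣x∣≤1 = ∣nonNeg∣≤ 0≤x (≤-trans x≤r (<⇒≤ r<1))

  1-x≤1 : 1ℚ - x ≤ 1ℚ
  1-x≤1 = subst (1ℚ - x ≤_) (+-identityʳ 1ℚ) (+-monoʳ-≤ 1ℚ (neg-antimono-≤ 0≤x))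

  ^≤1 : ∀ n → (1ℚ - x) ^ n ≤ 1ℚ
  ^≤1 zero    = ≤-refl
  ^≤1 (suc n) = subst ((1ℚ - x) ^ suc n ≤_) (*-identityʳ 1ℚ)
    (*-mono (<⇒≤ 0<1-x) 1-x≤1 (<⇒≤ (0<^ n 0<1-x)) (^≤1 n))

  ∣^∣≤1 : ∀ n → ∣ (1ℚ - x) ^ n ∣ ≤ 1ℚ
  ∣^∣≤1 n = ∣nonNeg∣≤ (<⇒≤ (0<^ n 0<1-x)) (^≤1 n)

  ∣^suc∣≤ : ∀ n → ∣ (1ℚ - x) ^ suc n ∣ ≤ 1ℚ - x
  ∣^suc∣≤ n = ∣nonNeg∣≤ (<⇒≤ (0<^ (suc n) 0<1-x)) (subst ((1ℚ - x) ^ suc n ≤_) (*-identityʳ (1ℚ - x))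
    (*-monoˡ-≤-nonNeg (1ℚ - x) {{nonNegative (<⇒≤ 0<1-x)}} (^≤1 n)))

-- (1 - x)ⁿ F x tends to c as x → 1⁻, uniformly over the truncations F M with M large.
AbelLimit : ℕ → (ℚ → ℕ → ℚ) → ℚ → Set
AbelLimit n F c = ∃ λ K → 0ℚ ≤ K × (∀ r → 0ℚ < r → r < 1ℚ → ∀ ε → 0ℚ < ε → ∃ λ M₀ →
  ∀ M → M₀ ℕ.≤ M → ∀ x → 0ℚ ≤ x → x ≤ r → ∣ (1ℚ - x) ^ n * F x M - c ∣ ≤ K * (1ℚ - x) + ε)

-- Summation by parts is multiplied by Q = (1 - x)^(d + 1). The term Q f₀ is at most |f₀| (1 - x)
-- because the exponent is positive, the boundary term takes half of `ε`, and replacing x c by c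
-- costs |c| (1 - x).
abel-step : ∀ {x r} d P P₁ fM f₀ p c K ε R → 0ℚ ≤ x → x ≤ r → r < 1ℚ →
  (1ℚ - x) * P + fM * p ≡ f₀ + x * P₁ → ∣ p ∣ ≤ R → ∣ fM ∣ * R ≤ ½ * ε →
  ∣ (1ℚ - x) ^ suc d * P₁ - c ∣ ≤ K * (1ℚ - x) + ½ * ε →
  ∣ (1ℚ - x) ^ suc (suc d) * P - c ∣ ≤ (∣ f₀ ∣ + K + ∣ c ∣) * (1ℚ - x) + ε
abel-step {x} d P P₁ fM f₀ p c K ε R 0≤x x≤r r<1 parts p≤R small ih = begin
  ∣ D * Q * P - c ∣
    ≡⟨ cong ∣_∣ decomposition ⟩
  ∣ ((Q * f₀ - Q * (fM * p)) + x * (Q * P₁ - c)) - D * c ∣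
    ≤⟨ ∣-∣-≤-+ ((Q * f₀ - Q * (fM * p)) + x * (Q * P₁ - c)) (D * c) ⟩
  ∣ (Q * f₀ - Q * (fM * p)) + x * (Q * P₁ - c) ∣ + ∣ D * c ∣
    ≤⟨ +-mono-≤ (∣p+q∣≤∣p∣+∣q∣ (Q * f₀ - Q * (fM * p)) (x * (Q * P₁ - c))) Dc ⟩
  (∣ Q * f₀ - Q * (fM * p) ∣ + ∣ x * (Q * P₁ - c) ∣) + D * ∣ c ∣
    ≤⟨ +-monoˡ-≤ (D * ∣ c ∣) (+-mono-≤ (∣-∣-≤-+ (Q * f₀) (Q * (fM * p))) (∣*∣-≤ {x} ∣x∣≤1 ih)) ⟩
  ((∣ Q * f₀ ∣ + ∣ Q * (fM * p) ∣) + 1ℚ * (K * D + ½ * ε)) + D * ∣ c ∣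
    ≤⟨ +-monoˡ-≤ (D * ∣ c ∣) (+-monoˡ-≤ (1ℚ * (K * D + ½ * ε)) (+-mono-≤
         (∣*∣-≤ {Q} {f₀} (∣^suc∣≤ d) ≤-refl) Qfp)) ⟩
  ((D * ∣ f₀ ∣ + 1ℚ * (½ * ε)) + 1ℚ * (K * D + ½ * ε)) + D * ∣ c ∣
    ≡⟨ S.solve 5 (λ D f K e c → ((D :* f :+ con 1ℚ :* e) :+ con 1ℚ :* (K :* D :+ e)) :+ D :* c :=
         (f :+ K :+ c) :* D :+ (e :+ e)) refl D (∣ f₀ ∣) K (½ * ε) (∣ c ∣) ⟩
  (∣ f₀ ∣ + K + ∣ c ∣) * D + (½ * ε + ½ * ε)
    ≡⟨ cong ((∣ f₀ ∣ + K + ∣ c ∣) * D +_) (halves ε) ⟩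
  (∣ f₀ ∣ + K + ∣ c ∣) * D + ε ∎
  where
  open ≤-Reasoning
  open UnitInterval 0≤x x≤r r<1
  D = 1ℚ - x
  Q = D ^ suc d
  decomposition : D * Q * P - c ≡ ((Q * f₀ - Q * (fM * p)) + x * (Q * P₁ - c)) - D * c
  decomposition = trans
    (S.solve 5 (λ x q P b c → (con 1ℚ :- x) :* q :* P :- c :=
        q :* ((con 1ℚ :- x) :* P :+ b) :- q :* b :- c) refl x Q P (fM * p) c)
    (trans (cong (λ t → Q * t - Q * (fM * p) - c) parts)
      (S.solve 6 (λ x q f b P c → q :* (f :+ x :* P) :- q :* b :- c :=
        ((q :* f :- q :* b) :+ x :* (q :* P :- c)) :- (con 1ℚ :- x) :* c) refl x Q f₀ (fM * p) P₁ c))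
  Dc : ∣ D * c ∣ ≤ D * ∣ c ∣
  Dc = ∣*∣-≤ {D} {c} (∣nonNeg∣≤ (<⇒≤ 0<1-x) ≤-refl) ≤-refl
  Qfp : ∣ Q * (fM * p) ∣ ≤ 1ℚ * (½ * ε)
  Qfp = ∣*∣-≤ {Q} {fM * p} (∣^∣≤1 (suc d)) (≤-trans (∣*∣-≤ {fM} {p} ≤-refl p≤R) small)

-- Each of the d differences uses up one factor 1 - x, and the remaining geometric series ∑ c xⁿ
-- uses the last one.
difference-abel : Difference d f c → AbelLimit (suc d) (partialSum f) c
-- For constant `f` the boundary term is the only error, hence K = 0.
difference-abel {f = f} {c} D@(constant eq) = 0ℚ , ≤-refl , λ r 0<r r<1 ε 0<ε →
  let M₀ , hM₀ = difference-decay D r 0<r r<1 ε 0<ε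
  in M₀ , λ M M₀≤M x 0≤x x≤r → subst₂ _≤_
       (trans (sym (∣-p∣≡∣p∣ (f M * x ^ M))) (cong ∣_∣ (identity x M)))
       (sym (trans (cong (_+ ε) (*-zeroˡ (1ℚ - x))) (+-identityˡ ε)))
       (≤-trans (∣*∣-≤ {f M} {x ^ M} ≤-refl (∣^∣≤ (∣nonNeg∣≤ 0≤x x≤r) M)) (hM₀ M M₀≤M))
  where
  identity : ∀ x M → - (f M * x ^ M) ≡ (1ℚ - x) * 1ℚ * partialSum f x M - c
  identity x M = begin
    - (f M * x ^ M)
      ≡⟨ S.solve 3 (λ D P b → :- b := D :* con 1ℚ :* P :- (D :* P :+ b)) refl
           (1ℚ - x) (partialSum f x M) (f M * x ^ M) ⟩
    (1ℚ - x) * 1ℚ * P - ((1ℚ - x) * P + f M * x ^ M)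
      ≡⟨ cong (λ t → (1ℚ - x) * 1ℚ * P - t) (summation-by-parts {f} {λ _ → 0ℚ}
           (λ n → trans (eq (suc n)) (trans (sym (eq n)) (sym (+-identityʳ (f n))))) x M) ⟩
    (1ℚ - x) * 1ℚ * P - (f 0 + x * partialSum (λ _ → 0ℚ) x M)
      ≡⟨ cong₂ (λ s t → (1ℚ - x) * 1ℚ * P - (s + x * t)) (eq 0) (partialSum-0 x M) ⟩
    (1ℚ - x) * 1ℚ * P - (c + x * 0ℚ)
      ≡⟨ cong (λ t → (1ℚ - x) * 1ℚ * P - t) (trans (cong (c +_) (*-zeroʳ x)) (+-identityʳ c)) ⟩
    (1ℚ - x) * 1ℚ * P - c ∎
    where
    open ≡-Reasoning
    P = partialSum f x M
difference-abel {suc d} {f} {c} D@(step {f′ = f′} eq D′) =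
  let K , 0≤K , hK = difference-abel D′
  in ∣ f 0 ∣ + K + ∣ c ∣ , 0≤+ (0≤+ (0≤∣p∣ (f 0)) 0≤K) (0≤∣p∣ c) , λ r 0<r r<1 ε 0<ε →
    let M₁ , hM₁ = difference-decay D r 0<r r<1 (½ * ε) (0<½* 0<ε)
        M₂ , hM₂ = hK r 0<r r<1 (½ * ε) (0<½* 0<ε)
    in M₁ ℕ.⊔ M₂ , λ M M≥ x 0≤x x≤r →
      abel-step d (partialSum f x M) (partialSum f′ x M) (f M) (f 0) (x ^ M) c K ε (r ^ M)
        0≤x x≤r r<1 (summation-by-parts {f} {f′} eq x M)
        (∣^∣≤ (∣nonNeg∣≤ 0≤x x≤r) M)
        (hM₁ M (ℕ.≤-trans (ℕ.m≤m⊔n M₁ M₂) M≥))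
        (hM₂ M (ℕ.≤-trans (ℕ.m≤n⊔m M₁ M₂) M≥) x 0≤x x≤r)

-- The sums in `partial` start at n = 1, which brings in a factor x; replacing it by 1 costs |ℓ| (1
-- - x).
summand-abel : ∀ s w → AbelLimit (degree (s ∷ w)) (partial (summand s w))
                                 (fromℕ (degree (s ∷ w) !) * C⁻ (s ∷ w))
summand-abel s w =
  let K , 0≤K , hK = difference-abel (summand-difference s w)
  in K + ∣ ℓ ∣ , 0≤+ 0≤K (0≤∣p∣ ℓ) , λ r 0<r r<1 ε 0<ε →
    let M₀ , hM₀ = hK r 0<r r<1 ε 0<ε
    in M₀ , λ M M≥ x 0≤x x≤r →
      subst (λ t → ∣ (1ℚ - x) ^ degree (s ∷ w) * t - ℓ ∣ ≤ (K + ∣ ℓ ∣) * (1ℚ - x) + ε)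
        (sym (partial≡ (summand s w) x M))
        (times-x ((1ℚ - x) ^ degree (s ∷ w)) (partialSum f′ x M) K ε 0≤x x≤r r<1 (hM₀ M M≥ x 0≤x x≤r))
  where
  ℓ = fromℕ (degree (s ∷ w) !) * C⁻ (s ∷ w)
  f′ : ℕ → ℚ
  f′ n = fromℕ (summand s w (suc n))
  times-x : ∀ {x r} Q P K ε → 0ℚ ≤ x → x ≤ r → r < 1ℚ → ∣ Q * P - ℓ ∣ ≤ K * (1ℚ - x) + ε →
            ∣ Q * (x * P) - ℓ ∣ ≤ (K + ∣ ℓ ∣) * (1ℚ - x) + ε
  times-x {x} Q P K ε 0≤x x≤r r<1 bound = begin
    ∣ Q * (x * P) - ℓ ∣
      ≡⟨ cong ∣_∣ (S.solve 4 (λ q x p ℓ → q :* (x :* p) :- ℓ :=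
           x :* (q :* p :- ℓ) :- (con 1ℚ :- x) :* ℓ) refl Q x P ℓ) ⟩
    ∣ x * (Q * P - ℓ) - (1ℚ - x) * ℓ ∣
      ≤⟨ ∣-∣-≤-+ (x * (Q * P - ℓ)) ((1ℚ - x) * ℓ) ⟩
    ∣ x * (Q * P - ℓ) ∣ + ∣ (1ℚ - x) * ℓ ∣
      ≤⟨ +-mono-≤ (∣*∣-≤ {x} {Q * P - ℓ} ∣x∣≤1 bound)
           (∣*∣-≤ {1ℚ - x} {ℓ} (∣nonNeg∣≤ (<⇒≤ 0<1-x) ≤-refl) ≤-refl) ⟩
    1ℚ * (K * (1ℚ - x) + ε) + (1ℚ - x) * ∣ ℓ ∣
      ≡⟨ S.solve 4 (λ k D e ℓ → con 1ℚ :* (k :* D :+ e) :+ D :* ℓ := (k :+ ℓ) :* D :+ e) refl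
           K (1ℚ - x) ε (∣ ℓ ∣) ⟩
    (K + ∣ ℓ ∣) * (1ℚ - x) + ε ∎
    where
    open ≤-Reasoning
    open UnitInterval 0≤x x≤r r<1

-- From rational estimates to real z

small-δ : ∀ K ε → 0ℚ ≤ K → 0ℚ < ε → ∃ λ δ → 0ℚ < δ × δ ≤ 1ℚ × K * δ ≤ ε
small-δ K ε 0≤K 0<ε with recip (1ℚ + K) (0<+ 0<1 0≤K)
-- The witness is the minimum of 1 and ε / (1 + K). The cap at 1 makes z > 1 - δ imply that z is
-- nonnegative.
... | i , 0<i , eq with ≤-total (i * ε) 1ℚ
...   | inj₁ iε≤1 = i * ε , 0<* 0<i 0<ε , iε≤1 , Kiε≤ε
  where
  Kiε≤ε : K * (i * ε) ≤ ε
  Kiε≤ε = subst₂ _≤_ (+-identityˡ (K * (i * ε)))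
    (trans (S.solve 3 (λ k i e → i :* e :+ k :* (i :* e) := (con 1ℚ :+ k) :* i :* e) refl K i ε)
      (trans (cong (_* ε) eq) (*-identityˡ ε)))
    (+-monoˡ-≤ (K * (i * ε)) (<⇒≤ (0<* 0<i 0<ε)))
...   | inj₂ 1≤iε = 1ℚ , 0<1 , ≤-refl , (begin
  K * 1ℚ                    ≤⟨ *-monoˡ-≤-nonNeg K {{nonNegative 0≤K}} 1≤iε ⟩
  K * (i * ε)               ≡⟨ sym (+-identityˡ (K * (i * ε))) ⟩
  0ℚ + K * (i * ε)          ≤⟨ +-monoˡ-≤ (K * (i * ε)) (<⇒≤ (0<* 0<i 0<ε)) ⟩
  i * ε + K * (i * ε)       ≡⟨ S.solve 3 (λ k i e → i :* e :+ k :* (i :* e) := (con 1ℚ :+ k) :* i :* e) refl K i ε ⟩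
  (1ℚ + K) * i * ε          ≡⟨ trans (cong (_* ε) eq) (*-identityˡ ε) ⟩
  ε                         ∎)
  where open ≤-Reasoning

-- With D = 1 - z, the coefficient of h⁻¹((1 - z)⁻¹) is D^n / F for F = n!.
normalise : ∀ (D F L C B : ℚ) n → 0ℚ < D → 1ℚ ≤ F → ∣ D ^ n * L - F * C ∣ ≤ B →
            ∣ inverse₀ (F * inverse₀ D ^ n) * L - C ∣ ≤ B
normalise D F L C B n 0<D 1≤F bound = begin
  ∣ y ∣           ≡⟨ sym (*-identityˡ (∣ y ∣)) ⟩
  1ℚ * ∣ y ∣      ≤⟨ *-monoʳ-≤-nonNeg (∣ y ∣) {{nonNegative (0≤∣p∣ y)}} (≤-trans 1≤F (p≤∣p∣ F)) ⟩
  ∣ F ∣ * ∣ y ∣   ≡⟨ sym (∣p*q∣≡∣p∣*∣q∣ F y) ⟩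
  ∣ F * y ∣       ≡⟨ cong ∣_∣ Fy ⟩
  ∣ D ^ n * L - F * C ∣ ≤⟨ bound ⟩
  B               ∎
  where
  open ≤-Reasoning
  i = inverse₀ D
  v = F * i ^ n
  j = inverse₀ v
  y = j * L - C
  vD : v * D ^ n ≡ F
  vD = trans (*-assoc F (i ^ n) (D ^ n)) (trans (cong (F *_)
    (trans (sym (^-distrib-* i D n)) (trans (cong (_^ n) (trans (*-comm i D)
      (inverse₀-inverse D λ D≡0 → <-irrefl (sym D≡0) 0<D))) (1^ n)))) (*-identityʳ F))
  v≢0 : v ≢ 0ℚ
  v≢0 v≡0 = <-irrefl (trans (sym (*-zeroˡ (D ^ n))) (trans (cong (_* D ^ n) (sym v≡0)) vD)) (<-≤-trans 0<1 1≤F)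
  Fy : F * y ≡ D ^ n * L - F * C
  Fy = trans (cong (_* y) (sym vD))
    (trans (S.solve 5 (λ v p j l c → v :* p :* (j :* l :- c) := (v :* j) :* p :* l :- v :* p :* c) refl
        v (D ^ n) j L C)
      (cong₂ (λ s t → s * L - t * C)
        (trans (cong (_* D ^ n) (inverse₀-inverse v v≢0)) (*-identityˡ (D ^ n))) vD))

module Approach (n : ℕ) (F C K ε δ : ℚ) (1≤F : 1ℚ ≤ F) (0≤K : 0ℚ ≤ K) (0<ε : 0ℚ < ε)
                (δ≤1 : δ ≤ 1ℚ) (Kδ≤ : K * δ ≤ ½ * (½ * ε)) where
  -- Error budget: K δ takes ε / 4, the Abel estimate and the truncation of the series take one `η`
  -- each. The total ε / 2 leaves the other half as the gap demanded by `<ᴿ`.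
  η = ½ * (½ * (½ * ε))
  0<η = 0<½* (0<½* (0<½* 0<ε))

  truncated : ∀ x L P → 1ℚ - δ ≤ x → ∣ (1ℚ - x) ^ n ∣ ≤ 1ℚ →
    ∣ P - L ∣ ≤ η → ∣ (1ℚ - x) ^ n * P - F * C ∣ ≤ K * (1ℚ - x) + η →
    ∣ (1ℚ - x) ^ n * L - F * C ∣ ≤ ½ * ε
  truncated x L P 1-δ≤x Q≤1 P≈L P≈C = begin
    ∣ Q * L - F * C ∣
      ≡⟨ cong ∣_∣ (S.solve 4 (λ q l p c → q :* l :- c := (q :* p :- c) :- q :* (p :- l)) refl Q L P (F * C)) ⟩
    ∣ (Q * P - F * C) - Q * (P - L) ∣
      ≤⟨ ∣-∣-≤-+ (Q * P - F * C) (Q * (P - L)) ⟩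
    ∣ Q * P - F * C ∣ + ∣ Q * (P - L) ∣
      ≤⟨ +-mono-≤ P≈C (∣*∣-≤ {Q} {P - L} Q≤1 P≈L) ⟩
    (K * (1ℚ - x) + η) + 1ℚ * η
      ≤⟨ +-monoˡ-≤ (1ℚ * η) (+-monoˡ-≤ η (≤-trans
           (*-monoˡ-≤-nonNeg K {{nonNegative 0≤K}} 1-x≤δ) Kδ≤)) ⟩
    (½ * (½ * ε) + η) + 1ℚ * η
      ≡⟨ S.solve 2 (λ t e → (t :+ e) :+ con 1ℚ :* e := t :+ (e :+ e)) refl (½ * (½ * ε)) η ⟩
    ½ * (½ * ε) + (η + η)
      ≡⟨ trans (cong (½ * (½ * ε) +_) (halves (½ * (½ * ε)))) (halves (½ * ε)) ⟩
    ½ * ε ∎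
    where
    open ≤-Reasoning
    Q = (1ℚ - x) ^ n
    1-x≤δ : 1ℚ - x ≤ δ
    1-x≤δ = diff-≤ {1ℚ - x} {δ} (subst (0ℚ ≤_)
      (S.solve 2 (λ x d → x :- (con 1ℚ :- d) := d :- (con 1ℚ :- x)) refl x δ) (≤-diff 1-δ≤x))

  pointwise : ∀ x r L P ε₁ ε₂ → r < 1ℚ → 0ℚ < ε₁ → 0ℚ < ε₂ →
    (1ℚ - δ) + ε₁ ≤ x → ∣ x ∣ ≤ r → ∣ P - L ∣ + ε₂ ≤ η →
    (0ℚ ≤ x → x ≤ r → ∣ (1ℚ - x) ^ n * P - F * C ∣ ≤ K * (1ℚ - x) + η) →
    ∣ inverse₀ (F * inverse₀ (1ℚ - x) ^ n) * L - C ∣ ≤ ½ * ε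
  pointwise x r L P ε₁ ε₂ r<1 0<ε₁ 0<ε₂ x> ∣x∣≤r P≈L P≈C =
    normalise (1ℚ - x) F L C (½ * ε) n 0<1-x 1≤F
      (truncated x L P 1-δ≤x (∣^∣≤1 n) (drop 0<ε₂ P≈L) (P≈C 0≤x x≤r))
    where
    drop : ∀ {p q e} → 0ℚ < e → p + e ≤ q → p ≤ q
    drop {p} {q} {e} 0<e = ≤-trans (subst (_≤ p + e) (+-identityʳ p) (+-monoʳ-≤ p (<⇒≤ 0<e)))
    1-δ≤x : 1ℚ - δ ≤ x
    1-δ≤x = drop 0<ε₁ x>
    0≤x : 0ℚ ≤ x
    0≤x = ≤-trans (≤-diff δ≤1) 1-δ≤x
    x≤r : x ≤ r
    x≤r = ≤-trans (p≤∣p∣ x) ∣x∣≤r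
    open UnitInterval 0≤x x≤r r<1

  -- The estimate is made at the rational approximations of `z`. The truncation M may depend on `z`:
  -- it must suit the Abel estimate on [0, r] and bring the partial sum close to `L`. As K is
  -- independent of r, `δ` can be fixed before `z`.
  near : ∀ a → (∀ r → 0ℚ < r → r < 1ℚ → ∀ ε → 0ℚ < ε → ∃ λ M₀ →
      ∀ M → M₀ ℕ.≤ M → ∀ x → 0ℚ ≤ x → x ≤ r →
      ∣ (1ℚ - x) ^ n * partial a x M - F * C ∣ ≤ K * (1ℚ - x) + ε) →
    ∀ z L → ∣ z ∣ᴿ <ᴿ 1ᴿ → fromℚ (1ℚ - δ) <ᴿ z → HasSum (powerSeries a z) L →
    Eventually λ k → ∣ inverse₀ (F * inverse₀ (1ℚ - seq z k) ^ n) * seq L k - C ∣ ≤ ½ * ε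
  near a abel z L ∣z∣<1 (ε₁ , 0<ε₁ , N₁ , z>) converges =
    let r , 0<r , r<1 , N₂ , z≤r = radius z ∣z∣<1
        M₀ , hM₀ = abel r 0<r r<1 η 0<η
        M₁ , hM₁ = converges η 0<η
        M = M₀ ℕ.⊔ M₁
        ε₂ , 0<ε₂ , N₃ , sum≈L = hM₁ M (ℕ.m≤n⊔m M₀ M₁)
        N , conditions = (N₁ , z>) ∩ (N₂ , z≤r) ∩ (N₃ , sum≈L)
    in N , λ k N≤k →
      let z>k , z≤rk , sum≈Lk = conditions k N≤k
      in pointwise (seq z k) r (seq L k) (partial a (seq z k) M) ε₁ ε₂ r<1 0<ε₁ 0<ε₂ z>k z≤rk
           (subst (λ t → ∣ t - seq L k ∣ + ε₂ ≤ η) (seq-partial a z M k) sum≈Lk)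
           (hM₀ M (ℕ.m≤m⊔n M₀ M₁) (seq z k))

abel-limit : ∀ a n F C → AbelLimit n (partial a) (F * C) → 1ℚ ≤ F → ∀ ε → 0ℚ < ε →
  ∃ λ δ → 0ℚ < δ × (∀ z L → ∣ z ∣ᴿ <ᴿ 1ᴿ → fromℚ (1ℚ - δ) <ᴿ z → HasSum (powerSeries a z) L →
    Eventually λ k → ∣ inverse₀ (F * inverse₀ (1ℚ - seq z k) ^ n) * seq L k - C ∣ ≤ ½ * ε)
abel-limit a n F C (K , 0≤K , abel) 1≤F ε 0<ε =
  let δ , 0<δ , δ≤1 , Kδ≤ = small-δ K (½ * (½ * ε)) 0≤K (0<½* (0<½* 0<ε))
  in δ , 0<δ , Approach.near n F C K ε δ 1≤F 0≤K 0<ε δ≤1 Kδ≤ a abel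

⊙-bound : ∀ R (R#0 : ∀ w → R w #0) T w k p C B → seq (R w) k ≡ p →
  ∣ inverse₀ p * seq (T w) k - C ∣ ≤ B → ∣ seq (((R ^⊙ᴿ-1) R#0 ⊙ᴿ T) w) k - C ∣ ≤ B
⊙-bound R R#0 T w k p C B refl bound = bound

seq-h : ∀ t w k → seq (h t w) k ≡ fromℕ (degree w !) * seq t k ^ degree w
seq-h t w k = cong (fromℕ (degree w !) *_) (seq-^ t (degree w) k)

-- Stated with a variable t: with (1 - z)⁻¹ in its place, comparing the two sides would evaluate
-- the decision p ≟ 0ℚ inside inverse₀.
Unfolding : Word → ∀ z → ∣ z ∣ᴿ <ᴿ 1ᴿ → Set
Unfolding w z ∣z∣<1 = ∃ λ t → ∃ λ t#0 →
  normalisedL z ∣z∣<1 w ≡ ((h t ^⊙ᴿ-1) (h#0 t t#0) ⊙ᴿ L⁻ z ∣z∣<1) w ×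
  (∀ k → seq t k ≡ inverse₀ (1ℚ - seq z k))

unfold-normalisedL : ∀ w z (∣z∣<1 : ∣ z ∣ᴿ <ᴿ 1ᴿ) → Unfolding w z ∣z∣<1
unfold-normalisedL w z ∣z∣<1 = _ , _ , refl , λ _ → refl

normalisedL-bound : ∀ w z (∣z∣<1 : ∣ z ∣ᴿ <ᴿ 1ᴿ) C B k → Unfolding w z ∣z∣<1 →
  ∣ inverse₀ (fromℕ (degree w !) * inverse₀ (1ℚ - seq z k) ^ degree w) * seq (L⁻ z ∣z∣<1 w) k - C ∣ ≤ B →
  ∣ seq (normalisedL z ∣z∣<1 w) k - C ∣ ≤ B
normalisedL-bound w z ∣z∣<1 C B k (t , t#0 , eq , seq-t) bound =
  subst (λ x → ∣ seq x k - C ∣ ≤ B) (sym eq)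
    (⊙-bound (h t) (h#0 t t#0) (L⁻ z ∣z∣<1) w k
      (fromℕ (degree w !) * inverse₀ (1ℚ - seq z k) ^ degree w) C B
      (trans (seq-h t w k) (cong (λ i → fromℕ (degree w !) * i ^ degree w) (seq-t k))) bound)

within : ∀ x c ε → 0ℚ < ε → Eventually (λ k → ∣ seq x k - c ∣ ≤ ½ * ε) → ∣ x -ᴿ fromℚ c ∣ᴿ <ᴿ fromℚ ε
within x c ε 0<ε (N , bound) = ½ * ε , 0<½* 0<ε , N , λ k N≤k →
  subst (∣ seq x k - c ∣ + ½ * ε ≤_) (halves ε) (+-monoˡ-≤ (½ * ε) (bound k N≤k))

normalisedL-limit : normalisedL ⟶1⁻ (λ w → fromℚ (C⁻ w))
-- The coefficient of the empty word is constantly 1, so any δ serves.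
normalisedL-limit []      ε 0<ε = 1ℚ , 0<1 , λ z ∣z∣<1 _ →
  within (normalisedL z ∣z∣<1 []) (C⁻ []) ε 0<ε
    (0 , λ k _ → normalisedL-bound [] z ∣z∣<1 (C⁻ []) (½ * ε) k (unfold-normalisedL [] z ∣z∣<1) (<⇒≤ (0<½* 0<ε)))
normalisedL-limit (s ∷ w) ε 0<ε =
  let δ , 0<δ , near = abel-limit (summand s w) (degree (s ∷ w)) (fromℕ (degree (s ∷ w) !)) (C⁻ (s ∷ w))
                         (summand-abel s w) (fromℕ-mono (ℕ.1≤n! (degree (s ∷ w)))) ε 0<ε
  in δ , 0<δ , λ z ∣z∣<1 z> →
    let N , bound = near z (L⁻ z ∣z∣<1 (s ∷ w)) ∣z∣<1 z> (proj₂ (Li-converges s w z ∣z∣<1))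
    in within (normalisedL z ∣z∣<1 (s ∷ w)) (C⁻ (s ∷ w)) ε 0<ε
         (N , λ k N≤k → normalisedL-bound (s ∷ w) z ∣z∣<1 (C⁻ (s ∷ w)) (½ * ε) k
           (unfold-normalisedL (s ∷ w) z ∣z∣<1) (bound k N≤k))

theorem9 : (((N : ℕ) → GroupLike (H⁻ N))
    × ((N : ℕ) → Primitive (log (H⁻ N)))
    × normalisedH ⟶∞ C⁻
    × normalisedL ⟶1⁻ (λ w → fromℚ (C⁻ w)))
    × IsPrimeIdeal ker-H⁻
theorem9 =
  (H⁻-groupLike , LogIsPrimitive.log-primitive , normalisedH-limit , normalisedL-limit) , ker-H⁻-prime
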